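{- Let $H$ be a digraph. Then $H$ is a hero in orientations of chordal graphs if and only if $H$ is a transitive tournament or $H$ is isomorphic to $\Delta(1,1,k)$ for some integer $k \geq 1$.
   Context: All digraphs are finite and simple: for two distinct vertices $u,v$ there is either an arc $uv$, or an arc $vu$, or neither, but never both (no loops, no parallel arcs, no digons). An orientation of a graph is a digraph obtained by choosing one direction for each edge; its underlying graph is obtained by forgetting directions. A graph is chordal if it has no induced cycle of length at least $4$; an orientation of a chordal graph is a digraph whose underlying graph is chordal. A $k$-dicolouring of a digraph $G$ is a map $c: V(G)\to\{1,\dots,k\}$ such that each colour class induces an acyclic subdigraph (no directed cycle); the dichromatic number $\vec{\chi}(G)$ is the least $k$ for which a $k$-dicolouring exists. A digraph $G$ is $H$-free if it contains no induced subdigraph isomorphic to $H$. For a hereditary class $\mathcal{C}$ of digraphs, $H$ is a hero in $\mathcal{C}$ if there is a constant $c$ such that every $H$-free digraph in $\mathcal{C}$ has dichromatic number at most $c$. A tournament is an orientation of a complete graph; a transitive tournament is an acyclic tournament, and $TT_k$ denotes the transitive tournament on $k$ vertices. For tournaments $H_1,H_2$, $\Delta(1,H_1,H_2)$ is the tournament obtained from disjoint copies of $H_1$ and $H_2$ and a new vertex $x$ by adding all arcs from $x$ to the copy of $H_1$, all arcs from the copy of $H_1$ to the copy of $H_2$, and all arcs from the copy of $H_2$ to $x$. We write $\Delta(1,k,\ell)$ for $\Delta(1,TT_k,TT_\ell)$; thus $\Delta(1,1,k)$ consists of vertices $x,y$ and a copy $T$ of $TT_k$, with arcs $x\to y$,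 $y\to t$ and $t\to x$ for all $t\in V(T)$. -}

module Defs where

open import Data.Nat using (ℕ; zero; suc; _≤_)
open import Data.Fin using (Fin; zero; suc; toℕ; inject₁; fromℕ)
open import Data.Bool using (Bool; true; false; _∨_)
open import Data.Product using (Σ; _×_; _,_; ∃; ∃-syntax)
open import Data.Sum using (_⊎_)
open import Data.Empty using (⊥)
open import Relation.Nullary using (¬_)
open import Relation.Binary.PropositionalEquality using (_≡_; _≢_; refl)
open import Function.Definitions using (Injective; Surjective)

record Digraph : Set where
  field
    n     : ℕ
    arc   : Fin n → Fin n → Bool
    loopless : ∀ u → arc u u ≡ false
    nodigon  : ∀ u v → arc u v ≡ true → arc v u ≡ false
open Digraph public

adj : (G : Digraph) → Fin (n G) → Fin (n G) → Bool
adj G u v = arc G u v ∨ arc G v u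

_↪ᵢ_ : Digraph → Digraph → Set
H ↪ᵢ G = Σ (Fin (n H) → Fin (n G)) λ f →
           Injective _≡_ _≡_ f × (∀ u v → arc H u v ≡ arc G (f u) (f v))

_-free : Digraph → Digraph → Set
(H -free) G = ¬ (H ↪ᵢ G)

_≅_ : Digraph → Digraph → Set
H ≅ K = Σ (Fin (n H) → Fin (n K)) λ f →
          Injective _≡_ _≡_ f × Surjective _≡_ _≡_ f ×
          (∀ u v → arc H u v ≡ arc K (f u) (f v))

CycAdj : (k : ℕ) → Fin k → Fin k → Set
CycAdj k i j =
  suc (toℕ i) ≡ toℕ j ⊎ suc (toℕ j) ≡ toℕ i ⊎
  (toℕ i ≡ 0 × suc (toℕ j) ≡ k) ⊎ (toℕ j ≡ 0 × suc (toℕ i) ≡ k)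

InducedCycle : (G : Digraph) → ℕ → Set
InducedCycle G k = Σ (Fin k → Fin (n G)) λ c →
  Injective _≡_ _≡_ c ×
  (∀ i j → i ≢ j → (adj G (c i) (c j) ≡ true → CycAdj k i j) ×
                   (CycAdj k i j → adj G (c i) (c j) ≡ true))

ChordalOrientation : Digraph → Set
ChordalOrientation G = ∀ k → 4 ≤ k → ¬ InducedCycle G k

IsDirCycle : (G : Digraph) (m : ℕ) → (Fin (suc m) → Fin (n G)) → Set
IsDirCycle G m w =
  Injective _≡_ _≡_ w ×
  (∀ (i : Fin m) → arc G (w (inject₁ i)) (w (suc i)) ≡ true) ×
  arc G (w (fromℕ m)) (w zero) ≡ true

Acyclic : Digraph → Set
Acyclic G = ∀ m (w : Fin (suc m) → Fin (n G)) → ¬ IsDirCycle G m w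

IsDicolouring : (G : Digraph) (k : ℕ) → (Fin (n G) → Fin k) → Set
IsDicolouring G k c =
  ∀ m (w : Fin (suc m) → Fin (n G)) → IsDirCycle G m w →
    ¬ (∀ i → c (w i) ≡ c (w zero))

Dicolourable : Digraph → ℕ → Set
Dicolourable G k = Σ (Fin (n G) → Fin k) (IsDicolouring G k)

HeroInChordalOrientations : Digraph → Set
HeroInChordalOrientations H =
  ∃[ c ] (∀ (G : Digraph) → ChordalOrientation G → (H -free) G → Dicolourable G c)

IsTournament : Digraph → Set
IsTournament G = ∀ u v → u ≢ v → arc G u v ≡ true ⊎ arc G v u ≡ true

IsTransitiveTournament : Digraph → Set
IsTransitiveTournament G = IsTournament G × Acyclic G

ltb : ℕ → ℕ → Bool
ltb zero    zero    = false
ltb zero    (suc _) = true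
ltb (suc _) zero    = false
ltb (suc a) (suc b) = ltb a b

ltb-irr : ∀ a → ltb a a ≡ false
ltb-irr zero    = refl
ltb-irr (suc a) = ltb-irr a

ltb-asym : ∀ a b → ltb a b ≡ true → ltb b a ≡ false
ltb-asym zero    (suc b) _ = refl
ltb-asym (suc a) (suc b) p = ltb-asym a b p

-- Δ(1,1,k): vertex 0 = x, vertex 1 = y, vertices 2+i form TT_k (2+i → 2+j iff i < j);
-- arcs x → y, y → t, t → x for every t in the TT_k.
Δarc : (k : ℕ) → Fin (suc (suc k)) → Fin (suc (suc k)) → Bool
Δarc k zero          (suc zero)    = true
Δarc k (suc zero)    (suc (suc _)) = true
Δarc k (suc (suc _)) zero          = true
Δarc k (suc (suc i)) (suc (suc j)) = ltb (toℕ i) (toℕ j)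
Δarc k _             _             = false

Δloop : ∀ k u → Δarc k u u ≡ false
Δloop k zero          = refl
Δloop k (suc zero)    = refl
Δloop k (suc (suc i)) = ltb-irr (toℕ i)

Δdigon : ∀ k u v → Δarc k u v ≡ true → Δarc k v u ≡ false
Δdigon k zero          (suc zero)    p = refl
Δdigon k (suc zero)    (suc (suc _)) p = refl
Δdigon k (suc (suc _)) zero          p = refl
Δdigon k (suc (suc i)) (suc (suc j)) p = ltb-asym (toℕ i) (toℕ j) p
Δdigon k zero          zero          ()
Δdigon k zero          (suc (suc _)) ()
Δdigon k (suc zero)    zero          ()
Δdigon k (suc zero)    (suc zero)    ()
Δdigon k (suc (suc _)) (suc zero)    ()

Δ11 : ℕ → Digraph
Δ11 k = record { n = suc (suc k) ; arc = Δarc k ; loopless = Δloop k ; nodigon = Δdigon k }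

{-# OPTIONS --safe #-}
module Submission where

open import Defs
open import Data.Nat as ℕ using (ℕ; zero; suc; _≤_; _<_; _≥_; _+_; _*_; _^_; _∸_; z≤n; s≤s)
import Data.Nat.Properties as ℕₚ
open import Data.Fin as Fin using (Fin; zero; suc; toℕ; inject₁; fromℕ)
import Data.Fin.Properties as Finₚ
open import Data.Bool as Bool using (Bool; true; false)
import Data.Bool.Properties as Boolₚ
open import Data.Product using (∃-syntax; _×_; _,_; proj₁; proj₂)
open import Data.Sum as Sum using (_⊎_; inj₁; inj₂; [_,_]′; swap)
open import Data.Empty using (⊥; ⊥-elim)
open import Data.List using (List; []; _∷_; _++_; length; filter; map; lookup; allFin; concat; replicate; take; cartesianProductWith)
open import Data.List.Membership.Propositional using (_∈_; _∉_; find; lose)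
open import Data.List.Membership.Propositional.Properties using (∈-filter⁺; ∈-filter⁻; ∈-++⁺ˡ; ∈-++⁺ʳ; ∈-++⁻; ∈-map⁺; ∈-lookup; ∈-allFin; ∈-cartesianProductWith⁺; ∈-map⁻)
open import Data.List.Relation.Unary.Any using (Any; here; there; any?; index)
open import Data.List.Relation.Unary.Any.Properties using (lookup-index)
open import Data.List.Relation.Unary.All as All using (All; []; _∷_)
open import Data.List.Relation.Unary.AllPairs as AllPairs using (AllPairs; []; _∷_)
open import Data.List.Properties using (filter-notAll; length-++; length-map; length-tabulate; map-++; ++-assoc; length-take; length-replicate; ≡-dec)
open import Relation.Nullary using (¬_; Dec; yes; no; ¬?; contradiction; does)
open import Relation.Nullary.Decidable using (_×-dec_; _⊎-dec_; decidable-stable; toSum; dec-true; _→-dec_)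
open import Relation.Unary using (Decidable)
open import Relation.Binary.PropositionalEquality using (_≡_; _≢_; refl; sym; trans; cong; subst; subst₂)
open import Relation.Binary.Construct.Closure.ReflexiveTransitive as Star using (Star; ε; _◅_; _◅◅_)
open import Function using (_∘_; id; case_of_)
open import Function.Definitions using (Injective; Surjective)
import Data.List.Relation.Unary.AllPairs.Properties as AllPairsₚ
open import Data.List.Relation.Unary.Unique.Propositional using (Unique)
import Data.List.Relation.Unary.Unique.Propositional.Properties as Uniqueₚ
open import Relation.Binary using (tri<; tri≈; tri>; DecidableEquality)
open import Relation.Binary.Construct.Closure.Transitive using (TransClosure; [_]; _∷_) renaming (_∷ʳ_ to _⁺∷ʳ_)
open import Data.Unit using (⊤)
open import Data.List.Relation.Binary.Sublist.Propositional as Sublist using (_⊆_; ⊆-refl; ⊆-reflexive; ⊆-trans; []; _∷_; _∷ʳ_)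
open import Data.List.Relation.Binary.Sublist.Propositional.Properties as Sublistₚ using (All-resp-⊆; filter-⊆; take-⊆)
import Data.List.Relation.Unary.All.Properties as Allₚ
import Data.List.Relation.Binary.Sublist.Heterogeneous as Hetero
open import Data.Maybe using (Maybe; just; nothing)
open import Data.Maybe.Properties using (just-injective)
open import Function.Bundles using (_⇔_; mk⇔)

-- Δ(1,1,k)-free implies bounded.  Colour greedily along a perfect elimination order.  If v is
-- simplicial, then only boundedly many b lie on a triangle v → a → b → v: otherwise Ramsey yields a
-- large transitive tournament of such b, and an a belonging to its source splits it into two parts,
-- one of which spans a Δ(1,1,k) together with v → a or with a → b.  Avoiding the colours of these b
-- leaves no monochromatic directed triangle, hence, as the graph is chordal, no monochromatic
-- directed cycle.  A transitive tournament embeds in some Δ(1,1,k).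
--
-- A simplicial vertex exists: grow a connected set A until its outer neighbours are complete to the
-- set R of vertices far from A.  A vertex simplicial in R is simplicial in the whole graph, since two
-- nonadjacent outer neighbours of A would close a hole through A and that vertex.
--
-- Conversely, tournaments of large dichromatic number force a hero to be a tournament.  The other
-- two families come from a game: Builder attaches a vertex to a clique, Painter colours it at once.
-- As all answers of Painter can be built into one chordal graph, a winning strategy of Builder gives
-- a chordal orientation of large dichromatic number whose cliques are those used by the strategy.
--  * With nested monochromatic arcs u → v and all later vertices t satisfying v → t → u, every
--    directed triangle contains an arc x → y such that each common neighbour w outside the triangle
--    satisfies y → w → x, unless w dominates the triangle or is dominated by it.
--  * No vertex dominates a directed triangle.  By induction on j, Builder forces, in front of any
--    transitive tournament T, arbitrarily many consecutive blocks each containing the same j colours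
--    D.  To gain a colour he repeatedly attaches z with R → z → L and z → S, where L is the list of
--    the previous z, R the next block and S all that follows; the colour of z cannot be in both D
--    and L, so eventually it is outside D, and z with one remaining block has j + 1 colours.
--    Repeating this in front of the result, still in front of T, and taking the most frequent
--    colour set gives the next step; j cannot exceed the number of colours.
-- Applying the second family and its reverse, a hero containing a directed triangle has no vertex
-- dominating or dominated by a directed triangle, so by the first family it is Δ(1,1,k).

search : ∀ {A : Set} {P : A → Set} → Decidable P → (xs : List A) →
         (∃[ x ] (x ∈ xs × P x)) ⊎ (∀ {x} → x ∈ xs → ¬ P x)
search P? xs with any? P? xs
... | yes p = inj₁ (find p)
... | no ¬p = inj₂ λ x∈xs px → ¬p (lose x∈xs px)

-- Adjacency in a digraph.

module Adjacency (G : Digraph) where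

  V : Set
  V = Fin (n G)

  infix 4 _⇒_ _~_

  _⇒_ _~_ : V → V → Set
  u ⇒ v = arc G u v ≡ true
  u ~ v = adj G u v ≡ true

  _⇒?_ : ∀ u v → Dec (u ⇒ v)
  u ⇒? v = arc G u v Bool.≟ true

  _~?_ : ∀ u v → Dec (u ~ v)
  u ~? v = adj G u v Bool.≟ true

  ~-split : ∀ {u v} → u ~ v → u ⇒ v ⊎ v ⇒ u
  ~-split {u} {v} p with arc G u v
  ... | true  = inj₁ refl
  ... | false = inj₂ p

  ⇒→~ : ∀ {u v} → u ⇒ v → u ~ v
  ⇒→~ p rewrite p = refl

  ~-sym : ∀ {u v} → u ~ v → v ~ u
  ~-sym {u} {v} p = trans (Boolₚ.∨-comm (arc G v u) (arc G u v)) p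

  ⇐→~ : ∀ {u v} → v ⇒ u → u ~ v
  ⇐→~ p = ~-sym (⇒→~ p)

  ⇒-asym : ∀ {u v} → u ⇒ v → v ⇒ u → ⊥
  ⇒-asym {u} {v} p q = contradiction (trans (sym q) (nodigon G u v p)) λ()

  ⇒-irrefl : ∀ {u} → u ⇒ u → ⊥
  ⇒-irrefl p = ⇒-asym p p

  ⇒⇒≢ : ∀ {u v} → u ⇒ v → u ≢ v
  ⇒⇒≢ p refl = ⇒-irrefl p

  ~-irrefl : ∀ {u} → u ~ u → ⊥
  ~-irrefl p = [ ⇒-irrefl , ⇒-irrefl ]′ (~-split p)

  ~⇒≢ : ∀ {u v} → u ~ v → u ≢ v
  ~⇒≢ p refl = ~-irrefl p

-- Simplicial vertices of chordal graphs.

module Simplicial (G : Digraph) (chordal : ChordalOrientation G) where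
  open Adjacency G

  -- An induced path from a to b, indexed by the vertices following a.
  data Path (b : V) : V → List V → Set where
    end  : Path b b []
    step : ∀ {a y zs} → a ~ y → All (λ z → a ≢ z × ¬ a ~ z) zs → Path b y zs → Path b a (y ∷ zs)

  far⇒≢ : ∀ {a y : V} {zs} → a ~ y → All (λ z → a ≢ z × ¬ a ~ z) zs → ∀ j → a ≢ lookup (y ∷ zs) j
  far⇒≢ a~y far zero    = ~⇒≢ a~y
  far⇒≢ a~y far (suc j) = proj₁ (All.lookup far (∈-lookup j))

  path-injective : ∀ {a b zs} → Path b a zs → Injective _≡_ _≡_ (lookup (a ∷ zs))
  path-injective p {zero} {zero} eq = refl
  path-injective (step a~y far p) {zero} {suc j} eq = contradiction eq (far⇒≢ a~y far j)
  path-injective (step a~y far p) {suc i} {zero} eq = contradiction (sym eq) (far⇒≢ a~y far i)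
  path-injective (step a~y far p) {suc i} {suc j} eq = cong suc (path-injective p eq)

  path-adj⇒ : ∀ {a b zs} → Path b a zs → ∀ i j → lookup (a ∷ zs) i ~ lookup (a ∷ zs) j →
              suc (toℕ i) ≡ toℕ j ⊎ suc (toℕ j) ≡ toℕ i
  path-adj⇒ p zero zero adj = ⊥-elim (~-irrefl adj)
  path-adj⇒ (step a~y far p) zero (suc zero) adj = inj₁ refl
  path-adj⇒ (step a~y far p) zero (suc (suc j)) adj = contradiction adj (proj₂ (All.lookup far (∈-lookup j)))
  path-adj⇒ (step a~y far p) (suc zero) zero adj = inj₂ refl
  path-adj⇒ (step a~y far p) (suc (suc j)) zero adj = contradiction (~-sym adj) (proj₂ (All.lookup far (∈-lookup j)))
  path-adj⇒ (step a~y far p) (suc i) (suc j) adj with path-adj⇒ p i j adj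
  ... | inj₁ eq = inj₁ (cong suc eq)
  ... | inj₂ eq = inj₂ (cong suc eq)

  path-adj⇐ : ∀ {a b zs} → Path b a zs → ∀ i j → suc (toℕ i) ≡ toℕ j →
              lookup (a ∷ zs) i ~ lookup (a ∷ zs) j
  path-adj⇐ (step a~y far p) zero (suc zero) eq = a~y
  path-adj⇐ (step a~y far p) (suc i) (suc j) eq = path-adj⇐ p i j (ℕₚ.suc-injective eq)

  path-last : ∀ {a b zs} → Path b a zs → ∀ i → suc (toℕ i) ≡ length (a ∷ zs) → lookup (a ∷ zs) i ≡ b
  path-last end zero eq = refl
  path-last (step a~y far p) (suc i) eq = path-last p i (ℕₚ.suc-injective eq)

  path-last⁻ : ∀ {a b zs} → Path b a zs → ∀ i → lookup (a ∷ zs) i ≡ b → suc (toℕ i) ≡ length (a ∷ zs)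
  path-last⁻ end zero eq = refl
  path-last⁻ {a} {b} {y ∷ zs} (step a~y far p) zero eq = contradiction eq (a≢b (step a~y far p))
    where
    a≢b : ∀ {a y zs} → Path b a (y ∷ zs) → a ≢ b
    a≢b (step a~y far end) = ~⇒≢ a~y
    a≢b (step a~y far p@(step _ _ _)) eq with path-end p
      where
      path-end : ∀ {a zs} → Path b a zs → b ∈ a ∷ zs
      path-end end = here refl
      path-end (step _ _ p) = there (path-end p)
    ... | here refl = ~⇒≢ a~y eq
    ... | there b∈  = proj₁ (All.lookup far b∈) eq
  path-last⁻ (step a~y far p) (suc i) eq = cong suc (path-last⁻ p i eq)

  -- Since `a` and `b` are distinct and nonadjacent, the induced path has at least three vertices;
  -- adding `v`, which sees only its ends, gives an induced cycle of length at least 4.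
  no-hole : ∀ {v a b zs} → Path b a zs → v ~ a → v ~ b → a ≢ b → ¬ a ~ b →
            (∀ {x} → x ∈ a ∷ zs → v ≢ x × (v ~ x → x ≡ a ⊎ x ≡ b)) → ⊥
  no-hole end _ _ a≢b _ _ = a≢b refl
  no-hole (step a~b _ end) _ _ _ a≁b _ = a≁b a~b
  no-hole {v} {a} {b} {zs} p@(step _ _ (step _ _ _)) v~a v~b a≢b a≁b near =
    chordal (length (v ∷ a ∷ zs)) (s≤s (s≤s (s≤s (s≤s z≤n)))) (c , c-injective , λ i j i≢j → to i j , from i j)
    where
    c : Fin (length (v ∷ a ∷ zs)) → V
    c = lookup (v ∷ a ∷ zs)

    near′ : ∀ i → v ≢ lookup (a ∷ zs) i × (v ~ lookup (a ∷ zs) i → lookup (a ∷ zs) i ≡ a ⊎ lookup (a ∷ zs) i ≡ b)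
    near′ i = near (∈-lookup i)

    c-injective : Injective _≡_ _≡_ c
    c-injective {zero} {zero} eq = refl
    c-injective {zero} {suc j} eq = contradiction eq (proj₁ (near′ j))
    c-injective {suc i} {zero} eq = contradiction (sym eq) (proj₁ (near′ i))
    c-injective {suc i} {suc j} eq = cong suc (path-injective p eq)

    k : ℕ
    k = length (v ∷ a ∷ zs)

    ends : ∀ j → v ~ lookup (a ∷ zs) j → toℕ j ≡ 0 ⊎ suc (toℕ j) ≡ length (a ∷ zs)
    ends j adj with proj₂ (near′ j) adj
    ... | inj₁ eq = inj₁ (cong toℕ (path-injective p {j} {zero} eq))
    ... | inj₂ eq = inj₂ (path-last⁻ p j eq)

    to : ∀ i j → c i ~ c j → CycAdj k i j
    to zero zero adj = ⊥-elim (~-irrefl adj)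
    to zero (suc j) adj with ends j adj
    ... | inj₁ eq = inj₁ (cong suc (sym eq))
    ... | inj₂ eq = inj₂ (inj₂ (inj₁ (refl , cong suc eq)))
    to (suc j) zero adj with ends j (~-sym adj)
    ... | inj₁ eq = inj₂ (inj₁ (cong suc (sym eq)))
    ... | inj₂ eq = inj₂ (inj₂ (inj₂ (refl , cong suc eq)))
    to (suc i) (suc j) adj with path-adj⇒ p i j adj
    ... | inj₁ eq = inj₁ (cong suc eq)
    ... | inj₂ eq = inj₂ (inj₁ (cong suc eq))

    from-v : ∀ j → toℕ j ≡ 0 ⊎ suc (toℕ j) ≡ length (a ∷ zs) → v ~ lookup (a ∷ zs) j
    from-v zero    (inj₁ eq) = v~a
    from-v (suc j) (inj₁ ())
    from-v j       (inj₂ eq) = subst (v ~_) (sym (path-last p j eq)) v~b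

    from : ∀ i j → CycAdj k i j → c i ~ c j
    from zero (suc j) (inj₁ eq) = from-v j (inj₁ (sym (ℕₚ.suc-injective eq)))
    from (suc i) (suc j) (inj₁ eq) = path-adj⇐ p i j (ℕₚ.suc-injective eq)
    from (suc i) zero (inj₂ (inj₁ eq)) = ~-sym (from-v i (inj₁ (sym (ℕₚ.suc-injective eq))))
    from (suc i) (suc j) (inj₂ (inj₁ eq)) = ~-sym (path-adj⇐ p j i (ℕₚ.suc-injective eq))
    from zero (suc j) (inj₂ (inj₂ (inj₁ (_ , eq)))) = from-v j (inj₂ (ℕₚ.suc-injective eq))
    from (suc i) zero (inj₂ (inj₂ (inj₂ (_ , eq)))) = ~-sym (from-v i (inj₂ (ℕₚ.suc-injective eq)))
    from (suc i) (suc j) (inj₂ (inj₂ (inj₁ (() , _))))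
    from (suc i) (suc j) (inj₂ (inj₂ (inj₂ (() , _))))

  -- The path is cut at its last vertex that equals `a` or is adjacent to it. No later vertex is
  -- near `a`, so the result is induced again.
  prepend : ∀ {a b y zs} → Path b y zs → Any (λ z → a ≡ z ⊎ a ~ z) (y ∷ zs) →
            ∃[ ws ] (Path b a ws × (∀ {x} → x ∈ ws → x ∈ y ∷ zs))
  prepend {a} {b} {y} {zs} p near with any? (λ z → (a Fin.≟ z) ⊎-dec (a ~? z)) zs
  prepend (step _ _ p) near | yes later with prepend p later
  ... | ws , q , ws⊆ = ws , q , there ∘ ws⊆
  prepend p (there later) | no ¬later = contradiction later ¬later
  prepend p (here (inj₁ refl)) | no ¬later = _ , p , there
  prepend {zs = zs} p (here (inj₂ a~y)) | no ¬later =
    _ , step a~y (All.tabulate λ z∈ → (λ eq → ¬later (lose z∈ (inj₁ eq))) , (λ adj → ¬later (lose z∈ (inj₂ adj)))) p , id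

  Walk : List V → V → V → Set
  Walk A = Star (λ u w → u ~ w × w ∈ A)

  walk⇒path : ∀ {A a b} → Walk A a b → ∃[ zs ] (Path b a zs × (∀ {x} → x ∈ zs → x ∈ A))
  walk⇒path ε = [] , end , λ ()
  walk⇒path ((a~y , y∈A) ◅ w) with walk⇒path w
  ... | zs , p , zs⊆A with prepend p (here (inj₂ a~y))
  ... | ws , q , ws⊆ = ws , q , λ x∈ → case ws⊆ x∈ of λ where
    (here refl) → y∈A
    (there x∈zs) → zs⊆A x∈zs

  data Connected : List V → Set where
    start : ∀ x → Connected (x ∷ [])
    grow  : ∀ {s t A} → s ~ t → t ∈ A → Connected A → Connected (s ∷ A)

  weaken : ∀ {A s u w} → Walk A u w → Walk (s ∷ A) u w
  weaken = Star.map λ { (adj , w∈) → adj , there w∈ }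

  connected⇒walk : ∀ {A u w} → Connected A → u ∈ A → w ∈ A → Walk A u w
  connected⇒walk (start x) (here refl) (here refl) = ε
  connected⇒walk (grow s~t t∈A conn) (here refl) (here refl) = ε
  connected⇒walk (grow s~t t∈A conn) (here refl) (there w∈) =
    (s~t , there t∈A) ◅ weaken (connected⇒walk conn t∈A w∈)
  connected⇒walk (grow s~t t∈A conn) (there u∈) (here refl) =
    weaken (connected⇒walk conn u∈ t∈A) ◅◅ ((~-sym s~t , here refl) ◅ ε)
  connected⇒walk (grow s~t t∈A conn) (there u∈) (there w∈) = weaken (connected⇒walk conn u∈ w∈)

  Touches : List V → V → Set
  Touches A v = Any (λ a → v ≡ a ⊎ v ~ a) A

  touches? : ∀ A → Decidable (Touches A)
  touches? A v = any? (λ a → (v Fin.≟ a) ⊎-dec (v ~? a)) A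

  Beside : List V → V → Set
  Beside A v = Any (v ~_) A

  -- A walk from `a` through `A` to `b` shortens to an induced path with interior in `A`, hence away
  -- from `v`. If `a` and `b` were nonadjacent, `v` would close it to a hole.
  common-neighbour : ∀ {A v a b} → Connected A → ¬ Touches A v → Beside A a → Beside A b →
                     v ~ a → v ~ b → a ≢ b → a ~ b
  common-neighbour {A} {v} {a} {b} conn v∉ a-A b-A v~a v~b a≢b
    with a₁ , a₁∈A , a~a₁ ← find a-A
    with b₁ , b₁∈A , b~b₁ ← find b-A
    with walk⇒path ((a~a₁ , there a₁∈A) ◅ (weaken (connected⇒walk conn a₁∈A b₁∈A) ◅◅ ((~-sym b~b₁ , here refl) ◅ ε)))
  ... | zs , p , zs⊆ = decidable-stable (a ~? b) λ a≁b → no-hole p v~a v~b a≢b a≁b near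
    where
    near : ∀ {x} → x ∈ a ∷ zs → v ≢ x × (v ~ x → x ≡ a ⊎ x ≡ b)
    near (here refl) = ~⇒≢ v~a , λ _ → inj₁ refl
    near (there x∈zs) with zs⊆ x∈zs
    ... | here refl = ~⇒≢ v~b , λ _ → inj₂ refl
    ... | there x∈A = (λ v≡x → v∉ (lose x∈A (inj₁ v≡x))) , λ v~x → ⊥-elim (v∉ (lose x∈A (inj₂ v~x)))

  IsSimplicial : List V → V → Set
  IsSimplicial S v = ∀ {a b} → a ∈ S → b ∈ S → v ~ a → v ~ b → a ≢ b → a ~ b

  remote : List V → List V → List V
  remote S A = filter (λ v → ¬? (touches? A v)) S

  Saturated : List V → List V → Set
  Saturated S A = ∀ {s t} → s ∈ S → Beside A s → s ∉ A → t ∈ remote S A → s ~ t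

  -- U covers S ∖ A and shrinks with every vertex added to A.
  saturate : ∀ fuel S A (U : List V) → length U ≤ fuel → (∀ {s} → s ∈ S → s ∉ A → s ∈ U) → ∀ {x t} →
             Connected A → x ∈ A → t ∈ remote S A →
             ∃[ A′ ] (∃[ t′ ] (Connected A′ × x ∈ A′ × t′ ∈ remote S A′ × Saturated S A′))
  saturate fuel S A U U≤ cover conn x∈ t∈
    with search (λ s → any? (s ~?_) A ×-dec ((¬? (any? (s Fin.≟_) A)) ×-dec any? (λ t → ¬? (s ~? t)) (remote S A))) S
  ... | inj₂ none = A , _ , conn , x∈ , t∈ , λ s∈S bes s∉A r∈ →
          decidable-stable (_ ~? _) λ s≁r → none s∈S (bes , s∉A , lose r∈ s≁r)
  saturate zero S A [] U≤ cover conn x∈ t∈ | inj₁ (s , s∈S , bes , s∉A , _) with () ← cover s∈S s∉A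
  saturate (suc fuel) S A U U≤ cover conn x∈ t∈ | inj₁ (s , s∈S , bes , s∉A , far)
    with u , u∈A , s~u ← find bes
    with r , r∈ , s≁r ← find far
    with r∈S , r∉ ← ∈-filter⁻ (λ v → ¬? (touches? A v)) {xs = S} r∈ =
    saturate fuel S (s ∷ A) (filter (λ w → ¬? (w Fin.≟ s)) U)
      (ℕₚ.≤-pred (ℕₚ.≤-trans (filter-notAll (λ w → ¬? (w Fin.≟ s)) U (lose (cover s∈S s∉A) (λ ne → ne refl))) U≤))
      (λ w∈S w∉ → ∈-filter⁺ (λ w → ¬? (w Fin.≟ s)) (cover w∈S (w∉ ∘ there)) (w∉ ∘ here))
      (grow s~u u∈A conn) (there x∈)
      -- The witness `r` stays remote, so the remote set never becomes empty: `r` is not adjacent to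
      -- `s`, and differs from `s` because `s` touches `A`.
      (∈-filter⁺ (λ v → ¬? (touches? (s ∷ A) v)) r∈S λ where
        (here (inj₁ refl)) → r∉ (lose u∈A (inj₂ s~u))
        (here (inj₂ r~s)) → s≁r (~-sym r~s)
        (there q) → r∉ q)

  -- Each neighbour of `v` in `S` is remote or lies beside `A`. Two remote ones are adjacent by
  -- hypothesis, a mixed pair by saturation, and two beside `A` by `common-neighbour`.
  remote-simplicial : ∀ {S A v} → Connected A → Saturated S A → v ∈ remote S A →
                      IsSimplicial (remote S A) v → IsSimplicial S v
  remote-simplicial {S} {A} {v} conn sat v∈R simp = simp′
    where
    v∉ : ¬ Touches A v
    v∉ = proj₂ (∈-filter⁻ (λ w → ¬? (touches? A w)) {xs = S} v∈R)

    place : ∀ {a} → a ∈ S → v ~ a → a ∈ remote S A ⊎ (Beside A a × a ∉ A)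
    place {a} a∈S v~a with touches? A a
    ... | no a∉ = inj₁ (∈-filter⁺ (λ w → ¬? (touches? A w)) a∈S a∉)
    ... | yes touch with find touch
    ... | a₁ , a₁∈A , inj₁ refl = ⊥-elim (v∉ (lose a₁∈A (inj₂ v~a)))
    ... | a₁ , a₁∈A , inj₂ a~a₁ = inj₂ (lose a₁∈A a~a₁ , λ a∈A → v∉ (lose a∈A (inj₂ v~a)))

    simp′ : IsSimplicial S v
    simp′ a∈S b∈S v~a v~b a≢b with place a∈S v~a | place b∈S v~b
    ... | inj₁ a∈R | inj₁ b∈R = simp a∈R b∈R v~a v~b a≢b
    ... | inj₁ a∈R | inj₂ (bes , b∉A) = ~-sym (sat b∈S bes b∉A a∈R)
    ... | inj₂ (bes , a∉A) | inj₁ b∈R = sat a∈S bes a∉A b∈R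
    ... | inj₂ (a-A , _) | inj₂ (b-A , _) = common-neighbour conn v∉ a-A b-A v~a v~b a≢b

  -- If `S` is not complete, some `x` has a non-neighbour, and `A` is grown from `x`. The recursion
  -- goes to the remote set, which is nonempty and omits `x`.
  simplicial-vertex : ∀ fuel S → length S ≤ fuel → ∀ {x} → x ∈ S → ∃[ v ] (v ∈ S × IsSimplicial S v)
  simplicial-vertex zero (_ ∷ _) () _
  simplicial-vertex (suc fuel) S S≤ x∈S
    with search (λ x → any? (λ r → ¬? (x Fin.≟ r) ×-dec ¬? (x ~? r)) S) S
  ... | inj₂ complete = _ , x∈S , λ a∈S b∈S _ _ a≢b →
          decidable-stable (_ ~? _) λ a≁b → complete a∈S (lose b∈S (a≢b , a≁b))
  ... | inj₁ (x , x∈ , far)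
    with r , r∈S , x≢r , x≁r ← find far
    with A , t , conn , x∈A , t∈ , sat ← saturate (length S) S (x ∷ []) S ℕₚ.≤-refl (λ s∈ _ → s∈) (start x) (here refl)
           (∈-filter⁺ (λ v → ¬? (touches? (x ∷ []) v)) r∈S λ where
             (here (inj₁ refl)) → x≢r refl
             (here (inj₂ r~x)) → x≁r (~-sym r~x))
    with v , v∈R , simp ← simplicial-vertex fuel (remote S A)
           (ℕₚ.≤-pred (ℕₚ.≤-trans (filter-notAll (λ w → ¬? (touches? A w)) S
             (lose x∈ λ x∉ → x∉ (lose x∈A (inj₁ refl)))) S≤)) t∈
    = v , proj₁ (∈-filter⁻ (λ w → ¬? (touches? A w)) {xs = S} v∈R) , remote-simplicial conn sat v∈R simp

-- Ramsey for tournaments and copies of Δ(1,1,k).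

length-filter-split : ∀ {A : Set} {P : A → Set} (P? : Decidable P) xs →
                      length (filter P? xs) + length (filter (¬? ∘ P?) xs) ≡ length xs
length-filter-split P? [] = refl
length-filter-split P? (x ∷ xs) with P? x
... | yes _ = cong suc (length-filter-split P? xs)
... | no  _ = trans (ℕₚ.+-suc _ _) (cong suc (length-filter-split P? xs))

-- The `suc` stands for the pivot that `transitive-sublist` takes out before splitting the rest.
large-part : ∀ {a b c} → a + b ≡ c → ∀ m → m + m ≤ suc c → m ≤ a ⊎ m ≤ b
large-part {a} {b} eq m m+m≤ with m ℕ.≤? a
... | yes m≤a = inj₁ m≤a
... | no m≰a = inj₂ (ℕₚ.+-cancelˡ-≤ (suc a) m b
        (ℕₚ.≤-trans (ℕₚ.+-monoˡ-≤ m (ℕₚ.≰⇒> m≰a)) (subst (λ c → m + m ≤ suc c) (sym eq) m+m≤)))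

missed-element : ∀ {K} (xs : List (Fin K)) → length xs < K → ∃[ x ] (x ∉ xs)
missed-element {K} xs short = Finₚ.¬∀⟶∃¬ K (_∈ xs) (λ x → any? (x Fin.≟_) xs) λ all∈ →
  ℕₚ.<⇒≱ short (Finₚ.injective⇒≤ {f = λ x → index (all∈ x)} λ {x} {y} eq →
    trans (lookup-index (all∈ x)) (trans (cong (lookup xs) eq) (sym (lookup-index (all∈ y)))))

ltb-< : ∀ {a b} → a < b → ltb a b ≡ true
ltb-< {zero}  {suc b} _         = refl
ltb-< {suc a} {suc b} (s≤s a<b) = ltb-< a<b

ltb-≥ : ∀ {a b} → b ≤ a → ltb a b ≡ false
ltb-≥ {zero}  {zero}  _         = refl
ltb-≥ {suc a} {zero}  _         = refl
ltb-≥ {suc a} {suc b} (s≤s b≤a) = ltb-≥ b≤a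

allPairs-lookup : ∀ {A : Set} {R : A → A → Set} {xs} → AllPairs R xs → ∀ i j → toℕ i < toℕ j →
                  R (lookup xs i) (lookup xs j)
allPairs-lookup (rx ∷ rxs) zero    (suc j) _         = All.lookup rx (∈-lookup j)
allPairs-lookup (rx ∷ rxs) (suc i) (suc j) (s≤s i<j) = allPairs-lookup rxs i j i<j

module Tournaments (G : Digraph) where
  open Adjacency G

  -- The out-neighbours or the in-neighbours of the first vertex `x` number at least `2 ^ p`. The
  -- transitive tournament found among them is extended by `x`, as its source or as its sink
  -- respectively.
  transitive-sublist : ∀ p xs → Unique xs → (∀ {a b} → a ∈ xs → b ∈ xs → a ≢ b → a ~ b) → 2 ^ p ≤ length xs →
                       ∃[ ys ] (length ys ≡ p × AllPairs _⇒_ ys × (∀ {x} → x ∈ ys → x ∈ xs))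
  transitive-sublist zero xs uniq clique big = [] , refl , [] , λ ()
  transitive-sublist (suc p) [] uniq clique big = ⊥-elim (ℕₚ.<⇒≱ (ℕₚ.m^n>0 2 (suc p)) big)
  transitive-sublist (suc p) (x ∷ xs) (x∉ ∷ uniq) clique big
    with large-part (length-filter-split (x ⇒?_) xs) (2 ^ p) (subst (λ q → 2 ^ p + q ≤ suc (length xs)) (ℕₚ.+-identityʳ (2 ^ p)) big)
  ... | inj₁ out-big
    with ys , len , trans-ys , ys⊆ ← transitive-sublist p (filter (x ⇒?_) xs) (Uniqueₚ.filter⁺ (x ⇒?_) uniq)
           (λ a∈ b∈ → clique (there (proj₁ (∈-filter⁻ (x ⇒?_) {xs = xs} a∈))) (there (proj₁ (∈-filter⁻ (x ⇒?_) {xs = xs} b∈)))) out-big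
    = x ∷ ys , cong suc len , All.tabulate (λ y∈ → proj₂ (∈-filter⁻ (x ⇒?_) {xs = xs} (ys⊆ y∈))) ∷ trans-ys , λ where
      (here refl) → here refl
      (there y∈)  → there (proj₁ (∈-filter⁻ (x ⇒?_) {xs = xs} (ys⊆ y∈)))
  ... | inj₂ in-big
    with ys , len , trans-ys , ys⊆ ← transitive-sublist p (filter (¬? ∘ (x ⇒?_)) xs) (Uniqueₚ.filter⁺ (¬? ∘ (x ⇒?_)) uniq)
           (λ a∈ b∈ → clique (there (proj₁ (∈-filter⁻ (¬? ∘ (x ⇒?_)) {xs = xs} a∈))) (there (proj₁ (∈-filter⁻ (¬? ∘ (x ⇒?_)) {xs = xs} b∈)))) in-big
    = ys ++ x ∷ [] , trans (length-++ ys) (trans (ℕₚ.+-comm (length ys) 1) (cong suc len)) ,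
      AllPairsₚ.++⁺ trans-ys ([] ∷ []) (All.tabulate λ y∈ → y⇒x y∈ ∷ []) , λ y∈ → case ∈-++⁻ ys y∈ of λ where
        (inj₁ y∈)         → there (proj₁ (∈-filter⁻ (¬? ∘ (x ⇒?_)) {xs = xs} (ys⊆ y∈)))
        (inj₂ (here refl)) → here refl
    where
    y⇒x : ∀ {y} → y ∈ ys → y ⇒ x
    y⇒x y∈ with y∈xs , x⇏y ← ∈-filter⁻ (¬? ∘ (x ⇒?_)) {xs = xs} (ys⊆ y∈)
      with ~-split (clique (there y∈xs) (here refl) (λ y≡x → All.lookup x∉ y∈xs (sym y≡x)))
    ... | inj₁ p = p
    ... | inj₂ p = contradiction p x⇏y

  Δ-embedding : ∀ {k x y ts} → k ≤ length ts → AllPairs _⇒_ ts → x ⇒ y → All (λ t → y ⇒ t × t ⇒ x) ts → Δ11 k ↪ᵢ G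
  Δ-embedding {k} {x} {y} {ts} k≤ trans-ts x⇒y all-ts = f , f-injective , arcs
    where
    t : Fin k → V
    t i = lookup ts (Fin.inject≤ i k≤)

    yt : ∀ i → y ⇒ t i
    yt i = proj₁ (All.lookup all-ts (∈-lookup _))

    tx : ∀ i → t i ⇒ x
    tx i = proj₂ (All.lookup all-ts (∈-lookup _))

    tt< : ∀ {i j} → toℕ i < toℕ j → t i ⇒ t j
    tt< {i} {j} i<j = allPairs-lookup trans-ts _ _
      (subst₂ _<_ (sym (Finₚ.toℕ-inject≤ i k≤)) (sym (Finₚ.toℕ-inject≤ j k≤)) i<j)

    f : Fin (suc (suc k)) → V
    f zero          = x
    f (suc zero)    = y
    f (suc (suc i)) = t i

    tt-injective : ∀ {i j} → t i ≡ t j → i ≡ j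
    tt-injective {i} {j} eq with ℕₚ.<-cmp (toℕ i) (toℕ j)
    ... | tri< i<j _ _ = contradiction eq (⇒⇒≢ (tt< i<j))
    ... | tri≈ _ i≡j _ = Finₚ.toℕ-injective i≡j
    ... | tri> _ _ j<i = contradiction (sym eq) (⇒⇒≢ (tt< j<i))

    f-injective : Injective _≡_ _≡_ f
    f-injective {zero} {zero} eq = refl
    f-injective {zero} {suc zero} eq = contradiction eq (⇒⇒≢ x⇒y)
    f-injective {zero} {suc (suc j)} eq = contradiction (sym eq) (⇒⇒≢ (tx j))
    f-injective {suc zero} {zero} eq = contradiction (sym eq) (⇒⇒≢ x⇒y)
    f-injective {suc zero} {suc zero} eq = refl
    f-injective {suc zero} {suc (suc j)} eq = contradiction eq (⇒⇒≢ (yt j))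
    f-injective {suc (suc i)} {zero} eq = contradiction eq (⇒⇒≢ (tx i))
    f-injective {suc (suc i)} {suc zero} eq = contradiction (sym eq) (⇒⇒≢ (yt i))
    f-injective {suc (suc i)} {suc (suc j)} eq = cong (λ l → suc (suc l)) (tt-injective eq)

    arcs : ∀ u v → Δarc k u v ≡ arc G (f u) (f v)
    arcs zero zero = sym (loopless G x)
    arcs zero (suc zero) = sym x⇒y
    arcs zero (suc (suc j)) = sym (nodigon G _ _ (tx j))
    arcs (suc zero) zero = sym (nodigon G _ _ x⇒y)
    arcs (suc zero) (suc zero) = sym (loopless G y)
    arcs (suc zero) (suc (suc j)) = sym (yt j)
    arcs (suc (suc i)) zero = sym (tx i)
    arcs (suc (suc i)) (suc zero) = sym (nodigon G _ _ (yt i))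
    arcs (suc (suc i)) (suc (suc j)) with ℕₚ.<-cmp (toℕ i) (toℕ j)
    ... | tri< i<j _ _ = trans (ltb-< i<j) (sym (tt< i<j))
    ... | tri≈ _ i≡j _ = trans (ltb-≥ (ℕₚ.≤-reflexive (sym i≡j)))
                           (sym (subst (λ l → arc G (t i) (t l) ≡ false) (Finₚ.toℕ-injective i≡j) (loopless G (t i))))
    ... | tri> _ _ j<i = trans (ltb-≥ (ℕₚ.<⇒≤ j<i)) (sym (nodigon G _ _ (tt< j<i)))

  -- By `transitive-sublist`, a clique of this size contains a transitive tournament on 2k + 1
  -- vertices: a source and 2k others, of which k fall on one side of `a` in `few-closing`.
  colours : ℕ → ℕ
  colours k = 2 ^ suc (k + k)

  Closing : List V → V → V → Set
  Closing S v b = b ⇒ v × Any (λ a → v ⇒ a × a ⇒ b) S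

  closing? : ∀ S v → Decidable (Closing S v)
  closing? S v b = (b ⇒? v) ×-dec any? (λ a → (v ⇒? a) ×-dec (a ⇒? b)) S

  -- In a transitive tournament of closing vertices with source b, fix a with v → a → b → v.
  -- The out-neighbours of a in it form a Δ(1,1,·) with the arc v → a, its in-neighbours one with the arc a → b.
  few-closing : ∀ {k S v} → Unique S → (∀ {a b} → a ∈ S → b ∈ S → v ~ a → v ~ b → a ≢ b → a ~ b) →
                (Δ11 k -free) G → length (filter (closing? S v) S) < colours k
  few-closing {k} {S} {v} uniq simp free with colours k ℕ.≤? length (filter (closing? S v) S)
  ... | no ¬big = ℕₚ.≰⇒> ¬big
  ... | yes big with transitive-sublist (suc (k + k)) (filter (closing? S v) S) (Uniqueₚ.filter⁺ (closing? S v) uniq) clique big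
    where
    clique : ∀ {a b} → a ∈ filter (closing? S v) S → b ∈ filter (closing? S v) S → a ≢ b → a ~ b
    clique a∈ b∈ with a∈S , a⇒v , _ ← ∈-filter⁻ (closing? S v) {xs = S} a∈
                 with b∈S , b⇒v , _ ← ∈-filter⁻ (closing? S v) {xs = S} b∈ = simp a∈S b∈S (⇐→~ a⇒v) (⇐→~ b⇒v)
  ... | b ∷ bs , len , b⇒bs ∷ trans-bs , bs⊆
    with b∈S , b⇒v , anyA ← ∈-filter⁻ (closing? S v) {xs = S} (bs⊆ (here refl))
    with a , a∈S , v⇒a , a⇒b ← find anyA
    with large-part (length-filter-split (a ⇒?_) bs) k (ℕₚ.≤-trans (ℕₚ.≤-reflexive (sym (ℕₚ.suc-injective len))) (ℕₚ.n≤1+n _))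
  ... | inj₁ out-big = ⊥-elim (free (Δ-embedding out-big (AllPairsₚ.filter⁺ (a ⇒?_) trans-bs) v⇒a (All.tabulate out)))
    where
    out : ∀ {t} → t ∈ filter (a ⇒?_) bs → a ⇒ t × t ⇒ v
    out t∈ with t∈bs , a⇒t ← ∈-filter⁻ (a ⇒?_) {xs = bs} t∈ =
      a⇒t , proj₁ (proj₂ (∈-filter⁻ (closing? S v) {xs = S} (bs⊆ (there t∈bs))))
  ... | inj₂ in-big = ⊥-elim (free (Δ-embedding in-big (AllPairsₚ.filter⁺ (¬? ∘ (a ⇒?_)) trans-bs) a⇒b (All.tabulate inn)))
    where
    inn : ∀ {t} → t ∈ filter (¬? ∘ (a ⇒?_)) bs → b ⇒ t × t ⇒ a
    inn t∈ with t∈bs , a⇏t ← ∈-filter⁻ (¬? ∘ (a ⇒?_)) {xs = bs} t∈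
      with t∈S , t⇒v , _ ← ∈-filter⁻ (closing? S v) {xs = S} (bs⊆ (there t∈bs))
      with ~-split (simp t∈S a∈S (⇐→~ t⇒v) (⇒→~ v⇒a) λ { refl → ⇒-asym t⇒v v⇒a })
    ... | inj₁ t⇒a = All.lookup b⇒bs t∈bs , t⇒a
    ... | inj₂ a⇒t = contradiction a⇒t a⇏t

-- Greedy colouring along simplicial vertices.

module Colouring (G : Digraph) (chordal : ChordalOrientation G) (k : ℕ) (free : (Δ11 k -free) G) where
  open Adjacency G
  open Simplicial G chordal
  open Tournaments G

  K : ℕ
  K = colours k

  MonoArc : List V → (V → Fin K) → V → V → Set
  MonoArc S c u w = (u ⇒ w × c u ≡ c w) × u ∈ S × w ∈ S

  -- Closed walks are excluded instead of injective cycles, so that a vertex can be cut out of a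
  -- walk without regard to repetitions.
  AcyclicOn : List V → (V → Fin K) → Set
  AcyclicOn S c = ∀ x → ¬ TransClosure (MonoArc S c) x x

  paint : (V → Fin K) → V → Fin K → V → Fin K
  paint c v x w with w Fin.≟ v
  ... | yes _ = x
  ... | no  _ = c w

  paint-new : ∀ c v x → paint c v x v ≡ x
  paint-new c v x with v Fin.≟ v
  ... | yes _ = refl
  ... | no ne = contradiction refl ne

  paint-old : ∀ c v x {w} → w ≢ v → paint c v x w ≡ c w
  paint-old c v x {w} ne with w Fin.≟ v
  ... | yes eq = contradiction eq ne
  ... | no _ = refl

  -- Suppose a monochromatic closed walk passes u → v → w. By simpliciality u and w are adjacent,
  -- and w → u would make u a closing vertex with the forbidden colour `x`. So u → w, and bypassing
  -- `v` leads to a closed walk in the smaller list.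
  paint-simplicial : ∀ {S v c x} → v ∈ S → IsSimplicial S v →
    AcyclicOn (filter (λ w → ¬? (w Fin.≟ v)) S) c → x ∉ map c (filter (closing? S v) S) →
    AcyclicOn S (paint c v x)
  paint-simplicial {S} {v} {c} {x} v∈S simp acyclic x∉ = acyclic′
    where
    S′ : List V
    S′ = filter (λ w → ¬? (w Fin.≟ v)) S
    c′ : V → Fin K
    c′ = paint c v x

    restrict : ∀ {u w} → u ≢ v → w ≢ v → MonoArc S c′ u w → MonoArc S′ c u w
    restrict u≢v w≢v ((u⇒w , eq) , u∈S , w∈S) =
      (u⇒w , trans (sym (paint-old c v x u≢v)) (trans eq (paint-old c v x w≢v))) ,
      ∈-filter⁺ (λ w → ¬? (w Fin.≟ v)) u∈S u≢v , ∈-filter⁺ (λ w → ¬? (w Fin.≟ v)) w∈S w≢v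

    shortcut : ∀ {u w} → MonoArc S c′ u v → MonoArc S c′ v w → MonoArc S c′ u w
    shortcut {u} {w} ((u⇒v , eq₁) , u∈S , _) ((v⇒w , eq₂) , _ , w∈S)
      with ~-split (simp u∈S w∈S (⇐→~ u⇒v) (⇒→~ v⇒w) λ { refl → ⇒-asym u⇒v v⇒w })
    ... | inj₁ u⇒w = (u⇒w , trans eq₁ eq₂) , u∈S , w∈S
    ... | inj₂ w⇒u = contradiction
            (subst (_∈ map c (filter (closing? S v) S))
              (trans (sym (paint-old c v x (⇒⇒≢ u⇒v))) (trans eq₁ (paint-new c v x)))
              (∈-map⁺ c (∈-filter⁺ (closing? S v) u∈S (u⇒v , lose w∈S (v⇒w , w⇒u)))))
            x∉

    is-v : ∀ y → y ≡ v ⊎ y ≢ v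
    is-v y = toSum (y Fin.≟ v)

    avoid : ∀ {u w} → u ≢ v → w ≢ v → TransClosure (MonoArc S c′) u w → TransClosure (MonoArc S′ c) u w
    avoid u≢v w≢v [ e ] = [ restrict u≢v w≢v e ]
    avoid u≢v w≢v (_∷_ {y = y} e p) with is-v y
    avoid u≢v w≢v (e ∷ p) | inj₂ y≢v = restrict u≢v y≢v e ∷ avoid y≢v w≢v p
    avoid u≢v w≢v (e ∷ [ e₂ ]) | inj₁ refl = [ restrict u≢v w≢v (shortcut e e₂) ]
    avoid u≢v w≢v (e ∷ (_∷_ {y = z} e₂ p)) | inj₁ refl = restrict u≢v z≢v (shortcut e e₂) ∷ avoid z≢v w≢v p
      where
      z≢v : z ≢ v
      z≢v refl = ⇒-irrefl (proj₁ (proj₁ e₂))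

    acyclic′ : AcyclicOn S c′
    acyclic′ y p with is-v y
    acyclic′ y p | inj₂ y≢v = acyclic y (avoid y≢v y≢v p)
    acyclic′ y [ e ] | inj₁ refl = ⇒-irrefl (proj₁ (proj₁ e))
    -- A closed walk based at `v` is rotated to its second vertex, which is not `v`.
    acyclic′ y (_∷_ {y = z} e p) | inj₁ refl = acyclic z (avoid z≢v z≢v (p ⁺∷ʳ e))
      where
      z≢v : z ≢ v
      z≢v refl = ⇒-irrefl (proj₁ (proj₁ e))

  colour : ∀ fuel S → length S ≤ fuel → Unique S → ∃[ c ] AcyclicOn S c
  colour fuel [] S≤ uniq = (λ _ → Fin.fromℕ< (ℕₚ.m^n>0 2 (suc (k + k)))) , λ where
    x [ (_ , () , _) ]
    x ((_ , () , _) ∷ _)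
  colour (suc fuel) S@(_ ∷ _) S≤ uniq
    with v , v∈S , simp ← simplicial-vertex (length S) S ℕₚ.≤-refl (here refl)
    with c , acyclic ← colour fuel (filter (λ w → ¬? (w Fin.≟ v)) S)
           (ℕₚ.≤-pred (ℕₚ.≤-trans (filter-notAll (λ w → ¬? (w Fin.≟ v)) S (lose v∈S λ ne → ne refl)) S≤))
           (Uniqueₚ.filter⁺ (λ w → ¬? (w Fin.≟ v)) uniq)
    with x , x∉ ← missed-element (map c (filter (closing? S v) S))
           (subst (_< K) (sym (length-map c (filter (closing? S v) S))) (few-closing uniq simp free))
    = paint c v x , paint-simplicial v∈S simp acyclic x∉

  walk-along : ∀ (R : V → V → Set) m (w : Fin (suc m) → V) → (∀ (i : Fin m) → R (w (inject₁ i)) (w (suc i))) →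
               ∀ {z} → R (w (fromℕ m)) z → TransClosure R (w zero) z
  walk-along R zero w steps last = [ last ]
  walk-along R (suc m) w steps last = steps zero ∷ walk-along R m (w ∘ suc) (steps ∘ suc) last

  dicolourable : Dicolourable G K
  dicolourable with colour (length (allFin (n G))) (allFin (n G)) ℕₚ.≤-refl (Uniqueₚ.allFin⁺ (n G))
  ... | c , acyclic = c , λ m w (inj , steps , last) mono →
    acyclic (w zero) (walk-along (MonoArc (allFin (n G)) c) m w
      (λ i → (steps i , trans (mono (inject₁ i)) (sym (mono (suc i)))) , ∈-allFin _ , ∈-allFin _)
      ((last , mono (fromℕ m)) , ∈-allFin _ , ∈-allFin _))

-- Transitive tournaments and recognition of Δ(1,1,k).

module _ {A : Set} {P Q : A → Set} (P? : Decidable P) (Q? : Decidable Q) (P⊆Q : ∀ {x} → P x → Q x) where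

  length-filter-mono-≤ : ∀ xs → length (filter P? xs) ≤ length (filter Q? xs)
  length-filter-mono-≤ [] = z≤n
  length-filter-mono-≤ (x ∷ xs) with P? x | Q? x
  ... | yes p | yes q = s≤s (length-filter-mono-≤ xs)
  ... | yes p | no ¬q = contradiction (P⊆Q p) ¬q
  ... | no ¬p | yes q = ℕₚ.m≤n⇒m≤1+n (length-filter-mono-≤ xs)
  ... | no ¬p | no ¬q = length-filter-mono-≤ xs

  length-filter-mono-< : ∀ {x xs} → x ∈ xs → Q x → ¬ P x → length (filter P? xs) < length (filter Q? xs)
  length-filter-mono-< {xs = y ∷ xs} (here refl) q ¬p with P? y | Q? y
  ... | yes p | _     = contradiction p ¬p
  ... | no _  | yes _ = s≤s (length-filter-mono-≤ xs)
  ... | no _  | no ¬q = contradiction q ¬q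
  length-filter-mono-< {xs = y ∷ xs} (there x∈) q ¬p with P? y | Q? y
  ... | yes p | yes q′ = s≤s (length-filter-mono-< x∈ q ¬p)
  ... | yes p | no ¬q  = contradiction (P⊆Q p) ¬q
  ... | no _  | yes _  = ℕₚ.m≤n⇒m≤1+n (length-filter-mono-< x∈ q ¬p)
  ... | no _  | no _   = length-filter-mono-< x∈ q ¬p

injective⇒surjective : ∀ {m n} → n ≤ m → {f : Fin m → Fin n} → Injective _≡_ _≡_ f → Surjective _≡_ _≡_ f
injective⇒surjective {m} {suc n} n≤m {f} inj y with Finₚ.any? (λ x → f x Fin.≟ y)
... | yes (x , eq) = x , λ { refl → eq }
... | no missed = contradiction n≤m (ℕₚ.<⇒≱ (s≤s (Finₚ.injective⇒≤ {f = λ x → Fin.punchOut (λ eq → missed (x , sym eq))}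
        λ {a} {b} eq → inj (Finₚ.punchOut-injective (λ e → missed (a , sym e)) (λ e → missed (b , sym e)) eq))))

module Ranking (H : Digraph) (tournament : IsTournament H) {P : Fin (n H) → Set} (P? : Decidable P) where
  open Adjacency H

  NoTriangle : Set
  NoTriangle = ∀ {a b c} → P a → P b → P c → a ⇒ b → b ⇒ c → c ⇒ a → ⊥

  below? : ∀ w v → Dec (P v × v ⇒ w)
  below? w v = P? v ×-dec (v ⇒? w)

  rank : V → ℕ
  rank w = length (filter (below? w) (allFin (n H)))

  module _ (no-triangle : NoTriangle) where

    -- Every in-neighbour v of `u` in `P` is one of `w`, since w → v would close a directed
    -- triangle, and `u` itself is an additional one. So the rank is the position in the transitive
    -- order.
    rank-< : ∀ {u w} → P u → P w → u ⇒ w → rank u < rank w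
    rank-< {u} {w} pu pw u⇒w = length-filter-mono-< (below? u) (below? w) below-mono (∈-allFin u) (pu , u⇒w) (⇒-irrefl ∘ proj₂)
      where
      below-mono : ∀ {v} → P v × v ⇒ u → P v × v ⇒ w
      below-mono {v} (pv , v⇒u) with tournament v w (λ { refl → ⇒-asym v⇒u u⇒w })
      ... | inj₁ v⇒w = pv , v⇒w
      ... | inj₂ w⇒v = ⊥-elim (no-triangle pv pu pw v⇒u u⇒w w⇒v)

    rank-arc : ∀ {u w} → P u → P w → arc H u w ≡ ltb (rank u) (rank w)
    rank-arc {u} {w} pu pw with u Fin.≟ w
    ... | yes refl = trans (loopless H u) (sym (ltb-irr (rank u)))
    ... | no u≢w with tournament u w u≢w
    ... | inj₁ u⇒w = trans u⇒w (sym (ltb-< (rank-< pu pw u⇒w)))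
    ... | inj₂ w⇒u = trans (nodigon H w u w⇒u) (sym (ltb-≥ (ℕₚ.<⇒≤ (rank-< pw pu w⇒u))))

    rank-injective : ∀ {u w} → P u → P w → rank u ≡ rank w → u ≡ w
    rank-injective {u} {w} pu pw eq with u Fin.≟ w
    ... | yes u≡w = u≡w
    ... | no u≢w with tournament u w u≢w
    ... | inj₁ u⇒w = contradiction eq (ℕₚ.<⇒≢ (rank-< pu pw u⇒w))
    ... | inj₂ w⇒u = contradiction (sym eq) (ℕₚ.<⇒≢ (rank-< pw pu w⇒u))

module _ (H : Digraph) where
  open Adjacency H

  corners : V → V → V → Fin 3 → V
  corners a b c zero             = a
  corners a b c (suc zero)       = b
  corners a b c (suc (suc zero)) = c

  triangle-cycle : ∀ {a b c} → a ⇒ b → b ⇒ c → c ⇒ a → IsDirCycle H 2 (corners a b c)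
  triangle-cycle {a} {b} {c} a⇒b b⇒c c⇒a = injective , steps , c⇒a
    where
    injective : Injective _≡_ _≡_ (corners a b c)
    injective {zero} {zero} eq = refl
    injective {zero} {suc zero} eq = contradiction eq (⇒⇒≢ a⇒b)
    injective {zero} {suc (suc zero)} eq = contradiction (sym eq) (⇒⇒≢ c⇒a)
    injective {suc zero} {zero} eq = contradiction (sym eq) (⇒⇒≢ a⇒b)
    injective {suc zero} {suc zero} eq = refl
    injective {suc zero} {suc (suc zero)} eq = contradiction eq (⇒⇒≢ b⇒c)
    injective {suc (suc zero)} {zero} eq = contradiction eq (⇒⇒≢ c⇒a)
    injective {suc (suc zero)} {suc zero} eq = contradiction (sym eq) (⇒⇒≢ b⇒c)
    injective {suc (suc zero)} {suc (suc zero)} eq = refl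

    steps : ∀ i → corners a b c (inject₁ i) ⇒ corners a b c (suc i)
    steps zero       = a⇒b
    steps (suc zero) = b⇒c

  -- Going along the cycle, its first vertex dominates each later one, as an arc back would close a
  -- directed triangle. So it dominates the last vertex, against the closing arc.
  no-triangle⇒acyclic : IsTournament H → (∀ {a b c} → a ⇒ b → b ⇒ c → c ⇒ a → ⊥) → Acyclic H
  no-triangle⇒acyclic tournament no-triangle zero w (inj , steps , last) = ⇒-irrefl last
  no-triangle⇒acyclic tournament no-triangle (suc m) w (inj , steps , last) = ⇒-asym last (dominates m (λ i → w (suc i)) (steps zero) (λ i → steps (suc i)) (λ i eq → contradiction (inj eq) λ()) )
    where
    dominates : ∀ m (v : Fin (suc m) → V) → w zero ⇒ v zero → (∀ (i : Fin m) → v (inject₁ i) ⇒ v (suc i)) →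
                (∀ i → w zero ≢ v i) → w zero ⇒ v (fromℕ m)
    dominates zero v first arcs distinct = first
    dominates (suc m) v first arcs distinct with tournament (w zero) (v (suc zero)) (distinct (suc zero))
    ... | inj₁ next = dominates m (v ∘ suc) next (λ i → arcs (suc i)) (λ i → distinct (suc i))
    ... | inj₂ back = ⊥-elim (no-triangle first (arcs zero) back)

  transitive-embedding : IsTransitiveTournament H → H ↪ᵢ Δ11 (n H)
  transitive-embedding (tournament , acyclic) =
    (λ u → suc (suc (Fin.fromℕ< (rank<n u)))) ,
    (λ {u} {w} eq → rank-injective no-triangle _ _ (rank-eq u w (Finₚ.suc-injective (Finₚ.suc-injective eq)))) ,
    λ u w → subst₂ (λ r s → arc H u w ≡ ltb r s) (sym (Finₚ.toℕ-fromℕ< (rank<n u))) (sym (Finₚ.toℕ-fromℕ< (rank<n w))) (rank-arc no-triangle _ _)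
    where
    open Ranking H tournament {P = λ _ → ⊤} (λ _ → yes _)

    no-triangle : NoTriangle
    no-triangle _ _ _ a⇒b b⇒c c⇒a = acyclic 2 _ (triangle-cycle a⇒b b⇒c c⇒a)

    rank<n : ∀ u → rank u < n H
    rank<n u = subst (rank u <_) (length-tabulate id)
      (filter-notAll (below? u) (allFin (n H)) (lose (∈-allFin u) (⇒-irrefl ∘ proj₂)))

    rank-eq : ∀ u w → Fin.fromℕ< (rank<n u) ≡ Fin.fromℕ< (rank<n w) → rank u ≡ rank w
    rank-eq u w eq = trans (sym (Finₚ.toℕ-fromℕ< (rank<n u))) (trans (cong toℕ eq) (Finₚ.toℕ-fromℕ< (rank<n w)))

  -- The vertices other than `x` and `y` are out-neighbours of `y`, hence contain no directed
  -- triangle and are ordered by rank. The vertex `z` makes `k` positive.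
  Δ-isomorphism : IsTournament H → ∀ {x y z} → x ⇒ y → (∀ {w} → w ≢ x → w ≢ y → y ⇒ w × w ⇒ x) →
                  z ≢ x → z ≢ y → (∀ {a b c} → y ⇒ a → y ⇒ b → y ⇒ c → a ⇒ b → b ⇒ c → c ⇒ a → ⊥) →
                  ∃[ k ] (k ≥ 1 × H ≅ Δ11 k)
  Δ-isomorphism tournament {x} {y} {z} x⇒y others z≢x z≢y no-triangle-y =
    k , ℕₚ.≤-trans (s≤s z≤n) (rank<k (z≢x , z≢y)) , f , f-injective , injective⇒surjective (ℕₚ.≤-reflexive 2+k≡n) f-injective , arcs
    where
    P : V → Set
    P w = w ≢ x × w ≢ y

    P? : Decidable P
    P? w = ¬? (w Fin.≟ x) ×-dec ¬? (w Fin.≟ y)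

    open Ranking H tournament P?

    no-triangle : NoTriangle
    no-triangle (a₁ , a₂) (b₁ , b₂) (c₁ , c₂) = no-triangle-y (proj₁ (others a₁ a₂)) (proj₁ (others b₁ b₂)) (proj₁ (others c₁ c₂))

    k : ℕ
    k = n H ∸ 2

    -- Besides the in-neighbours counted by the rank there are `w`, `y` and `x`, let in one at a
    -- time by weaker filters.
    3+rank≤n : ∀ {w} → P w → 3 + rank w ≤ n H
    3+rank≤n {w} pw = begin
      3 + rank w
        ≤⟨ s≤s (s≤s (length-filter-mono-< (below? w) P? proj₁ (∈-allFin w) pw (⇒-irrefl ∘ proj₂))) ⟩
      2 + length (filter P? (allFin (n H)))
        ≤⟨ s≤s (length-filter-mono-< P? (λ v → ¬? (v Fin.≟ x)) proj₁ (∈-allFin y) (λ y≡x → ⇒⇒≢ x⇒y (sym y≡x)) (λ p → proj₂ p refl)) ⟩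
      1 + length (filter (λ v → ¬? (v Fin.≟ x)) (allFin (n H)))
        ≤⟨ filter-notAll (λ v → ¬? (v Fin.≟ x)) (allFin (n H)) (lose (∈-allFin x) λ ne → ne refl) ⟩
      length (allFin (n H)) ≡⟨ length-tabulate id ⟩
      n H ∎
      where open ℕₚ.≤-Reasoning

    2+k≡n : 2 + k ≡ n H
    2+k≡n = ℕₚ.m+[n∸m]≡n (ℕₚ.≤-trans (s≤s (s≤s z≤n)) (3+rank≤n (z≢x , z≢y)))

    rank<k : ∀ {w} → P w → rank w < k
    rank<k {w} pw = ℕₚ.≤-pred (ℕₚ.≤-pred (subst (3 + rank w ≤_) (sym 2+k≡n) (3+rank≤n pw)))

    data Place (w : V) : Set where
      at-x  : w ≡ x → Place w
      at-y  : w ≡ y → Place w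
      apart : P w → Place w

    place : ∀ w → Place w
    place w with w Fin.≟ x | w Fin.≟ y
    ... | yes w≡x | _       = at-x w≡x
    ... | no _    | yes w≡y = at-y w≡y
    ... | no w≢x  | no w≢y  = apart (w≢x , w≢y)

    value : ∀ {w} → Place w → Fin (2 + k)
    value (at-x _)   = zero
    value (at-y _)   = suc zero
    value (apart pw) = suc (suc (Fin.fromℕ< (rank<k pw)))

    f : V → Fin (2 + k)
    f w = value (place w)

    toℕ-value : ∀ {w} (pw : P w) → toℕ (Fin.fromℕ< (rank<k pw)) ≡ rank w
    toℕ-value pw = Finₚ.toℕ-fromℕ< (rank<k pw)

    value-injective : ∀ {u w} (p : Place u) (q : Place w) → value p ≡ value q → u ≡ w
    value-injective (at-x refl) (at-x refl) eq = refl
    value-injective (at-y refl) (at-y refl) eq = refl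
    value-injective (apart pu) (apart pw) eq = rank-injective no-triangle pu pw
      (trans (sym (toℕ-value pu)) (trans (cong toℕ (Finₚ.suc-injective (Finₚ.suc-injective eq))) (toℕ-value pw)))

    f-injective : Injective _≡_ _≡_ f
    f-injective {u} {w} = value-injective (place u) (place w)

    arc-value : ∀ {u w} (p : Place u) (q : Place w) → arc H u w ≡ Δarc k (value p) (value q)
    arc-value (at-x refl) (at-x refl) = loopless H x
    arc-value (at-x refl) (at-y refl) = x⇒y
    arc-value (at-x refl) (apart (w≢x , w≢y)) = nodigon H _ _ (proj₂ (others w≢x w≢y))
    arc-value (at-y refl) (at-x refl) = nodigon H _ _ x⇒y
    arc-value (at-y refl) (at-y refl) = loopless H y
    arc-value (at-y refl) (apart (w≢x , w≢y)) = proj₁ (others w≢x w≢y)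
    arc-value (apart (u≢x , u≢y)) (at-x refl) = proj₂ (others u≢x u≢y)
    arc-value (apart (u≢x , u≢y)) (at-y refl) = nodigon H _ _ (proj₁ (others u≢x u≢y))
    arc-value (apart pu) (apart pw) rewrite toℕ-value pu | toℕ-value pw = rank-arc no-triangle pu pw

    arcs : ∀ u w → arc H u w ≡ Δarc k (f u) (f w)
    arcs u w = arc-value (place u) (place w)

-- The game: boards, moves and won positions.

Arcs : Set
Arcs = ℕ → ℕ → Bool

Adj : Arcs → ℕ → ℕ → Set
Adj ρ u v = ρ u v ≡ true ⊎ ρ v u ≡ true

_∈ᵇ_ : ℕ → List ℕ → Bool
u ∈ᵇ us = does (any? (u ℕ.≟_) us)

∈ᵇ-true : ∀ {u us} → u ∈ us → u ∈ᵇ us ≡ true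
∈ᵇ-true {u} {us} = dec-true (any? (u ℕ.≟_) us)

∈ᵇ-true⁻ : ∀ {u us} → u ∈ᵇ us ≡ true → u ∈ us
∈ᵇ-true⁻ {u} {us} p with any? (u ℕ.≟_) us
... | yes u∈ = u∈

data JoinArc (m : ℕ) (outs ins : List ℕ) (ρ : Arcs) (u v : ℕ) : Set where
  into  : v ≡ m → u ∈ ins → JoinArc m outs ins ρ u v
  outof : v ≢ m → u ≡ m → v ∈ outs → JoinArc m outs ins ρ u v
  old   : u ≢ m → v ≢ m → ρ u v ≡ true → JoinArc m outs ins ρ u v

record IsJoin (m : ℕ) (outs ins : List ℕ) (ρ ρ′ : Arcs) : Set where
  field
    join-in  : ∀ {u} → u ∈ ins → ρ′ u m ≡ true
    join-out : ∀ {v} → v ≢ m → v ∈ outs → ρ′ m v ≡ true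
    join-old : ∀ {u v} → u ≢ m → v ≢ m → ρ′ u v ≡ ρ u v
    join-arc : ∀ {u v} → ρ′ u v ≡ true → JoinArc m outs ins ρ u v

join : ∀ m outs ins ρ → ∃[ ρ′ ] IsJoin m outs ins ρ ρ′
join m outs ins ρ = ρ′ , record
  { join-in = join-in ; join-out = join-out ; join-old = join-old ; join-arc = λ {u} {v} → join-arc u v }
  where
  ρ′ : Arcs
  ρ′ u v with v ℕ.≟ m | u ℕ.≟ m
  ... | yes _ | _     = u ∈ᵇ ins
  ... | no  _ | yes _ = v ∈ᵇ outs
  ... | no  _ | no  _ = ρ u v

  join-in : ∀ {u} → u ∈ ins → ρ′ u m ≡ true
  join-in u∈ with m ℕ.≟ m
  ... | yes _ = ∈ᵇ-true u∈
  ... | no ne = contradiction refl ne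

  join-out : ∀ {v} → v ≢ m → v ∈ outs → ρ′ m v ≡ true
  join-out {v} v≢m v∈ with v ℕ.≟ m | m ℕ.≟ m
  ... | yes eq | _     = contradiction eq v≢m
  ... | no _   | yes _ = ∈ᵇ-true v∈
  ... | no _   | no ne = contradiction refl ne

  join-old : ∀ {u v} → u ≢ m → v ≢ m → ρ′ u v ≡ ρ u v
  join-old {u} {v} u≢m v≢m with v ℕ.≟ m | u ℕ.≟ m
  ... | yes eq | _      = contradiction eq v≢m
  ... | no _   | yes eq = contradiction eq u≢m
  ... | no _   | no _   = refl

  join-arc : ∀ u v → ρ′ u v ≡ true → JoinArc m outs ins ρ u v
  join-arc u v p with v ℕ.≟ m | u ℕ.≟ m
  ... | yes v≡m | _       = into v≡m (∈ᵇ-true⁻ p)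
  ... | no v≢m  | yes u≡m = outof v≢m u≡m (∈ᵇ-true⁻ p)
  ... | no v≢m  | no u≢m  = old u≢m v≢m p

Agree : ℕ → Arcs → Arcs → Set
Agree m ρ ρ′ = ∀ {u v} → u < m → v < m → ρ u v ≡ ρ′ u v

-- What a construction guarantees about a directed triangle a → b → c → a and a common neighbour
-- `w`. Locality lets the guarantee survive when later vertices are added.
record Quadruple : Set₁ where
  field
    Holds : Arcs → (a b c w : ℕ) → Set
    local : ∀ {m ρ ρ′} → Agree m ρ ρ′ → ∀ {a b c w} → a < m → b < m → c < m → w < m →
            Holds ρ a b c w → Holds ρ′ a b c w

-- A game in which vertices are added one at a time, each to a clique, and coloured at once.
-- Vertices are labelled by their time of arrival, so the labels form a perfect elimination order.
module Game (K : ℕ) (Θ : Quadruple) where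
  open Quadruple Θ

  record Board : Set where
    field
      size    : ℕ
      ρ       : Arcs
      bounded : ∀ {u v} → ρ u v ≡ true → u < size × v < size
      asym    : ∀ {u v} → ρ u v ≡ true → ρ v u ≡ true → ⊥
      elim    : ∀ {u v w} → u < w → v < w → u ≢ v → Adj ρ u w → Adj ρ v w → Adj ρ u v
      quad    : ∀ {a b c w} → ρ a b ≡ true → ρ b c ≡ true → ρ c a ≡ true →
                Adj ρ w a → Adj ρ w b → Adj ρ w c → Holds ρ a b c w
  open Board public

  empty : Board
  empty = record { size = 0 ; ρ = λ _ _ → false ; bounded = λ () ; asym = λ () ; elim = λ { _ _ _ (inj₁ ()) _ ; _ _ _ (inj₂ ()) _ } ; quad = λ () }

  infix 4 _⊑_
  record _⊑_ (G G′ : Board) : Set where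
    field
      size-≤ : size G ≤ size G′
      agree  : Agree (size G) (ρ G) (ρ G′)
  open _⊑_ public

  ⊑-refl : ∀ {G} → G ⊑ G
  ⊑-refl = record { size-≤ = ℕₚ.≤-refl ; agree = λ _ _ → refl }

  ⊑-trans : ∀ {G₁ G₂ G₃} → G₁ ⊑ G₂ → G₂ ⊑ G₃ → G₁ ⊑ G₃
  ⊑-trans p q = record
    { size-≤ = ℕₚ.≤-trans (size-≤ p) (size-≤ q)
    ; agree  = λ u< v< → trans (agree p u< v<) (agree q (ℕₚ.≤-trans u< (size-≤ p)) (ℕₚ.≤-trans v< (size-≤ p))) }

  arc-mono : ∀ {G G′} → G ⊑ G′ → ∀ {u v} → ρ G u v ≡ true → ρ G′ u v ≡ true
  arc-mono {G} p uv with u< , v< ← bounded G uv = trans (sym (agree p u< v<)) uv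

  adj-mono : ∀ {G G′} → G ⊑ G′ → ∀ {u v} → Adj (ρ G) u v → Adj (ρ G′) u v
  adj-mono p (inj₁ uv) = inj₁ (arc-mono p uv)
  adj-mono p (inj₂ vu) = inj₂ (arc-mono p vu)

  -- `new-quad` speaks of any later label `z` and any arcs agreeing with the board below `size G`,
  -- because the board may have grown by the time the vertex is attached; `attachable-mono` depends
  -- on this.
  record Attachable (G : Board) (outs ins : List ℕ) : Set where
    field
      disjoint : ∀ {v} → v ∈ outs → v ∈ ins → ⊥
      below    : ∀ {v} → v ∈ outs ++ ins → v < size G
      clique   : ∀ {u v} → u ∈ outs ++ ins → v ∈ outs ++ ins → u ≢ v → Adj (ρ G) u v
      new-quad : ∀ {ρ′ z} → size G ≤ z → Agree (size G) (ρ G) ρ′ → (∀ {u v} → ρ′ u v ≡ true → ρ′ v u ≡ true → ⊥) →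
                 (∀ {v} → v ∈ outs → ρ′ z v ≡ true) → (∀ {v} → v ∈ ins → ρ′ v z ≡ true) →
                 ∀ {a b c w} → a ∈ z ∷ outs ++ ins → b ∈ z ∷ outs ++ ins → c ∈ z ∷ outs ++ ins → w ∈ z ∷ outs ++ ins →
                 ρ′ a b ≡ true → ρ′ b c ≡ true → ρ′ c a ≡ true →
                 Adj ρ′ w a → Adj ρ′ w b → Adj ρ′ w c → Holds ρ′ a b c w

  attachable-mono : ∀ {G G′ outs ins} → G ⊑ G′ → Attachable G outs ins → Attachable G′ outs ins
  attachable-mono p att = record
    { disjoint = disjoint
    ; below    = λ v∈ → ℕₚ.≤-trans (below v∈) (size-≤ p)
    ; clique   = λ u∈ v∈ u≢v → adj-mono p (clique u∈ v∈ u≢v)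
    ; new-quad = λ z≥ ag → new-quad (ℕₚ.≤-trans (size-≤ p) z≥)
                   λ u< v< → trans (agree p u< v<) (ag (ℕₚ.≤-trans u< (size-≤ p)) (ℕₚ.≤-trans v< (size-≤ p)))
    }
    where open Attachable att

  module Attach (G : Board) {outs ins : List ℕ} (att : Attachable G outs ins)
                {ρ′ : Arcs} (joined : IsJoin (size G) outs ins (ρ G) ρ′) where
    open IsJoin joined
    private
      module A = Attachable att
      m : ℕ
      m = size G

    below-outs : ∀ {v} → v ∈ outs → v < m
    below-outs v∈ = A.below (∈-++⁺ˡ v∈)

    below-ins : ∀ {v} → v ∈ ins → v < m
    below-ins v∈ = A.below (∈-++⁺ʳ outs v∈)

    out-arc : ∀ {v} → v ∈ outs → ρ′ m v ≡ true
    out-arc v∈ = join-out (ℕₚ.<⇒≢ (below-outs v∈)) v∈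

    in-arc : ∀ {v} → v ∈ ins → ρ′ v m ≡ true
    in-arc v∈ = join-in v∈

    agree′ : Agree m (ρ G) ρ′
    agree′ u< v< = sym (join-old (ℕₚ.<⇒≢ u<) (ℕₚ.<⇒≢ v<))

    neighbour : ∀ {v} → Adj ρ′ m v → v ∈ outs ++ ins
    neighbour (inj₁ mv) with join-arc mv
    ... | into _ m∈ = contradiction refl (ℕₚ.<⇒≢ (below-ins m∈))
    ... | outof _ _ v∈ = ∈-++⁺ˡ v∈
    ... | old ne _ _ = contradiction refl ne
    neighbour (inj₂ vm) with join-arc vm
    ... | into _ v∈ = ∈-++⁺ʳ outs v∈
    ... | outof ne _ _ = contradiction refl ne
    ... | old _ ne _ = contradiction refl ne

    bounded′ : ∀ {u v} → ρ′ u v ≡ true → u < suc m × v < suc m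
    bounded′ uv with join-arc uv
    ... | into refl u∈ = ℕₚ.m≤n⇒m≤1+n (below-ins u∈) , ℕₚ.≤-refl
    ... | outof _ refl v∈ = ℕₚ.≤-refl , ℕₚ.m≤n⇒m≤1+n (below-outs v∈)
    ... | old _ _ p with u< , v< ← bounded G p = ℕₚ.m≤n⇒m≤1+n u< , ℕₚ.m≤n⇒m≤1+n v<

    asym′ : ∀ {u v} → ρ′ u v ≡ true → ρ′ v u ≡ true → ⊥
    asym′ uv vu with join-arc uv | join-arc vu
    ... | into refl u∈ | into refl _ = ℕₚ.<⇒≢ (below-ins u∈) refl
    ... | into refl u∈ | outof _ _ u∈′ = A.disjoint u∈′ u∈
    ... | into refl _ | old ne _ _ = ne refl
    ... | outof _ refl v∈ | into _ v∈′ = A.disjoint v∈ v∈′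
    ... | outof _ refl _ | outof ne _ _ = ne refl
    ... | outof _ refl _ | old _ ne _ = ne refl
    ... | old _ ne _ | outof _ eq _ = ne eq
    ... | old ne _ _ | into eq _ = ne eq
    ... | old _ _ p | old _ _ q = asym G p q

    old-adj : ∀ {u v} → u ≢ m → v ≢ m → Adj ρ′ u v → Adj (ρ G) u v
    old-adj u≢m v≢m (inj₁ p) = inj₁ (trans (sym (join-old u≢m v≢m)) p)
    old-adj u≢m v≢m (inj₂ p) = inj₂ (trans (sym (join-old v≢m u≢m)) p)

    lift-adj : ∀ {u v} → Adj (ρ G) u v → Adj ρ′ u v
    lift-adj (inj₁ p) with u< , v< ← bounded G p = inj₁ (trans (sym (agree′ u< v<)) p)
    lift-adj (inj₂ p) with u< , v< ← bounded G p = inj₂ (trans (sym (agree′ u< v<)) p)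

    adj-bounded : ∀ {u v} → Adj (ρ G) u v → u < m × v < m
    adj-bounded (inj₁ p) = bounded G p
    adj-bounded (inj₂ p) with u< , v< ← bounded G p = v< , u<

    is-new : ∀ v → v ≡ m ⊎ v ≢ m
    is-new v = toSum (v ℕ.≟ m)

    elim′ : ∀ {u v w} → u < w → v < w → u ≢ v → Adj ρ′ u w → Adj ρ′ v w → Adj ρ′ u v
    elim′ {u} {v} {w} u<w v<w u≢v uw vw with is-new w
    ... | inj₁ refl = lift-adj (A.clique (neighbour (swap uw)) (neighbour (swap vw)) u≢v)
    ... | inj₂ w≢m = lift-adj (elim G u<w v<w u≢v (old-adj (u≢m u<w) w≢m uw) (old-adj (u≢m v<w) w≢m vw))
      where
      w≤m : w ≤ m
      w≤m = [ (λ p → ℕₚ.≤-pred (proj₂ (bounded′ p))) , (λ p → ℕₚ.≤-pred (proj₁ (bounded′ p))) ]′ uw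
      u≢m : ∀ {u} → u < w → u ≢ m
      u≢m u<w refl = ℕₚ.<⇒≱ u<w w≤m

    -- If one of the four vertices is new, the others are its neighbours and `new-quad` applies; if
    -- none is, the old guarantee is transported by `local`.
    quad′ : ∀ {a b c w} → ρ′ a b ≡ true → ρ′ b c ≡ true → ρ′ c a ≡ true →
            Adj ρ′ w a → Adj ρ′ w b → Adj ρ′ w c → Holds ρ′ a b c w
    quad′ {a} {b} {c} {w} ab bc ca wa wb wc with is-new a | is-new b | is-new c | is-new w
    ... | inj₁ refl | _ | _ | _ = A.new-quad ℕₚ.≤-refl agree′ asym′ out-arc in-arc
      (here refl) (there (neighbour (inj₁ ab))) (there (neighbour (inj₂ ca))) (there (neighbour (swap wa))) ab bc ca wa wb wc
    ... | inj₂ _ | inj₁ refl | _ | _ = A.new-quad ℕₚ.≤-refl agree′ asym′ out-arc in-arc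
      (there (neighbour (inj₂ ab))) (here refl) (there (neighbour (inj₁ bc))) (there (neighbour (swap wb))) ab bc ca wa wb wc
    ... | inj₂ _ | inj₂ _ | inj₁ refl | _ = A.new-quad ℕₚ.≤-refl agree′ asym′ out-arc in-arc
      (there (neighbour (inj₁ ca))) (there (neighbour (inj₂ bc))) (here refl) (there (neighbour (swap wc))) ab bc ca wa wb wc
    ... | inj₂ _ | inj₂ _ | inj₂ _ | inj₁ refl = A.new-quad ℕₚ.≤-refl agree′ asym′ out-arc in-arc
      (there (neighbour wa)) (there (neighbour wb)) (there (neighbour wc)) (here refl) ab bc ca wa wb wc
    ... | inj₂ a≢m | inj₂ b≢m | inj₂ c≢m | inj₂ w≢m =
      local agree′ (proj₁ (bounded G ab₀)) (proj₁ (bounded G bc₀)) (proj₁ (bounded G ca₀)) (proj₁ (adj-bounded wa₀))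
        (quad G ab₀ bc₀ ca₀ wa₀ (old-adj w≢m b≢m wb) (old-adj w≢m c≢m wc))
      where
      ab₀ : ρ G a b ≡ true
      ab₀ = trans (sym (join-old a≢m b≢m)) ab
      bc₀ : ρ G b c ≡ true
      bc₀ = trans (sym (join-old b≢m c≢m)) bc
      ca₀ : ρ G c a ≡ true
      ca₀ = trans (sym (join-old c≢m a≢m)) ca
      wa₀ : Adj (ρ G) w a
      wa₀ = old-adj w≢m a≢m wa

    board : Board
    board = record { size = suc m ; ρ = ρ′ ; bounded = bounded′ ; asym = asym′ ; elim = elim′ ; quad = quad′ }

    extends : G ⊑ board
    extends = record { size-≤ = ℕₚ.n≤1+n m ; agree = agree′ }

  Coloured : Set
  Coloured = ℕ × Fin K

  _⊨_ : (ℕ → Fin K) → List Coloured → Set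
  c ⊨ Γ = All (λ (v , x) → c v ≡ x) Γ

  MonoTriangle : Board → (ℕ → Fin K) → Set
  MonoTriangle G c = ∃[ u ] (∃[ v ] (∃[ w ] ((ρ G u v ≡ true × ρ G v w ≡ true × ρ G w u ≡ true) × c u ≡ c v × c v ≡ c w)))

  -- `Γ` records the answers of Painter so far. The board `G₁` is arbitrary above `G` so that the
  -- boards for different answers can be combined into one that defeats every colouring.
  Win : Board → List Coloured → Set
  Win G Γ = ∀ G₁ → G ⊑ G₁ → ∃[ G₂ ] (G₁ ⊑ G₂ × (∀ c → c ⊨ Γ → MonoTriangle G₂ c))

  mono-triangle-mono : ∀ {G G′ c} → G ⊑ G′ → MonoTriangle G c → MonoTriangle G′ c
  mono-triangle-mono p (u , v , w , (uv , vw , wu) , eqs) = u , v , w , (arc-mono p uv , arc-mono p vw , arc-mono p wu) , eqs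

  win-triangle : ∀ {G Γ u v w x} → ρ G u v ≡ true → ρ G v w ≡ true → ρ G w u ≡ true →
                 (u , x) ∈ Γ → (v , x) ∈ Γ → (w , x) ∈ Γ → Win G Γ
  win-triangle uv vw wu u∈ v∈ w∈ G₁ p = G₁ , ⊑-refl , λ c sat → mono-triangle-mono p
    (_ , _ , _ , (uv , vw , wu) , trans (All.lookup sat u∈) (sym (All.lookup sat v∈)) , trans (All.lookup sat v∈) (sym (All.lookup sat w∈)))

  win-weaken : ∀ {G Γ Γ′} → (∀ {p} → p ∈ Γ → p ∈ Γ′) → Win G Γ → Win G Γ′
  win-weaken Γ⊆ win G₁ p with G₂ , q , mono ← win G₁ p = G₂ , q , λ c sat → mono c (All.tabulate (All.lookup sat ∘ Γ⊆))

  -- The finitely many boards for the possible colours of z can be built on top of each other.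
  all-replies : ∀ {G z Γ} (xs : List (Fin K)) → (∀ x → Win G ((z , x) ∷ Γ)) → ∀ G₁ → G ⊑ G₁ →
                ∃[ G₂ ] (G₁ ⊑ G₂ × (∀ c → c ⊨ Γ → c z ∈ xs → MonoTriangle G₂ c))
  all-replies [] wins G₁ p = G₁ , ⊑-refl , λ _ _ ()
  all-replies (x ∷ xs) wins G₁ p
    with G₂ , q , mono ← wins x G₁ p
    with G₃ , r , mono′ ← all-replies xs wins G₂ (⊑-trans p q) = G₃ , ⊑-trans q r , λ where
      c sat (here eq)  → mono-triangle-mono r (mono c (eq ∷ sat))
      c sat (there x∈) → mono′ c sat x∈

  -- A colouring of the final board gives the new vertex some colour, and the play against that
  -- answer provides the triangle. The vertex joins the actual board `G₁`, so only `size G ≤ z` is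
  -- known.
  attach : ∀ {G Γ outs ins} → Attachable G outs ins →
           (∀ G′ z → G ⊑ G′ → size G ≤ z → z < size G′ →
              (∀ {v} → v ∈ outs → ρ G′ z v ≡ true) → (∀ {v} → v ∈ ins → ρ G′ v z ≡ true) →
              ∀ x → Win G′ ((z , x) ∷ Γ)) →
           Win G Γ
  attach {outs = outs} {ins} att play G₁ p with ρ′ , joined ← join (size G₁) outs ins (ρ G₁) = result
    where
    open Attach G₁ (attachable-mono p att) joined
    result : ∃[ G₂ ] (G₁ ⊑ G₂ × (∀ c → c ⊨ _ → MonoTriangle G₂ c))
    result with G₂ , q , mono ← all-replies (allFin K)
                  (play board (size G₁) (⊑-trans p extends) (size-≤ p) ℕₚ.≤-refl out-arc in-arc) board ⊑-refl
      = G₂ , ⊑-trans extends q , λ c sat → mono c sat (∈-allFin _)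

  winning-board : Win empty [] → ∃[ G ] (∀ c → MonoTriangle G c)
  winning-board win with G , _ , mono ← win empty ⊑-refl = G , λ c → mono c []

-- Transitively ordered lists and pigeonhole.

AllPairs-resp-⊆ : ∀ {A : Set} {R : A → A → Set} {xs ys} → xs ⊆ ys → AllPairs R ys → AllPairs R xs
AllPairs-resp-⊆ []         []         = []
AllPairs-resp-⊆ (_ ∷ʳ τ)   (_ ∷ rs)   = AllPairs-resp-⊆ τ rs
AllPairs-resp-⊆ (refl ∷ τ) (r ∷ rs)   = All-resp-⊆ τ r ∷ AllPairs-resp-⊆ τ rs

AllPairs-++⁻ : ∀ {A : Set} {R : A → A → Set} xs {ys} → AllPairs R (xs ++ ys) → ∀ {x y} → x ∈ xs → y ∈ ys → R x y
AllPairs-++⁻ (x ∷ xs) (r ∷ rs) (here refl) y∈ = All.lookup r (∈-++⁺ʳ xs y∈)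
AllPairs-++⁻ (x ∷ xs) (r ∷ rs) (there x∈)  y∈ = AllPairs-++⁻ xs rs x∈ y∈

AllPairs-total : ∀ {A : Set} {R : A → A → Set} {xs} → AllPairs R xs → ∀ {x y} → x ∈ xs → y ∈ xs → x ≢ y → R x y ⊎ R y x
AllPairs-total (r ∷ rs) (here refl) (here refl) x≢y = contradiction refl x≢y
AllPairs-total (r ∷ rs) (here refl) (there y∈)  x≢y = inj₁ (All.lookup r y∈)
AllPairs-total (r ∷ rs) (there x∈)  (here refl) x≢y = inj₂ (All.lookup r x∈)
AllPairs-total (r ∷ rs) (there x∈)  (there y∈)  x≢y = AllPairs-total rs x∈ y∈ x≢y

-- Of three vertices, the first in the list sends arcs to both others, so the arc of the triangle
-- into it contradicts asymmetry.
no-cyclic-triangle : ∀ {A : Set} {R : A → A → Set} → (∀ {u v} → R u v → R v u → ⊥) → ∀ {xs} → AllPairs R xs →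
                     ∀ {a b c} → a ∈ xs → b ∈ xs → c ∈ xs → R a b → R b c → R c a → ⊥
no-cyclic-triangle asym (r ∷ rs) (here refl) (here refl) _           ab bc ca = asym ab ab
no-cyclic-triangle asym (r ∷ rs) (here refl) (there _)   (here refl) ab bc ca = asym ca ca
no-cyclic-triangle asym (r ∷ rs) (here refl) (there _)   (there c∈)  ab bc ca = asym ca (All.lookup r c∈)
no-cyclic-triangle asym (r ∷ rs) (there a∈)  (here refl) _           ab bc ca = asym ab (All.lookup r a∈)
no-cyclic-triangle asym (r ∷ rs) (there a∈)  (there b∈)  (here refl) ab bc ca = asym bc (All.lookup r b∈)
no-cyclic-triangle asym (r ∷ rs) (there a∈)  (there b∈)  (there c∈)  ab bc ca = no-cyclic-triangle asym rs a∈ b∈ c∈ ab bc ca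

∈-++-rotate : ∀ {A : Set} (L R S : List A) {v} → v ∈ (L ++ S) ++ R → v ∈ L ++ R ++ S
∈-++-rotate L R S v∈ with ∈-++⁻ (L ++ S) v∈
... | inj₂ v∈R = ∈-++⁺ʳ L (∈-++⁺ˡ v∈R)
... | inj₁ v∈LS with ∈-++⁻ L v∈LS
...   | inj₁ v∈L = ∈-++⁺ˡ v∈L
...   | inj₂ v∈S = ∈-++⁺ʳ L (∈-++⁺ʳ R v∈S)

unique-length : ∀ {K} {xs : List (Fin K)} → Unique xs → length xs ≤ K
unique-length {xs = xs} uniq = Finₚ.injective⇒≤ {f = lookup xs} λ {i} {j} eq → case ℕₚ.<-cmp (toℕ i) (toℕ j) of λ where
  (tri< i<j _ _) → contradiction eq (allPairs-lookup uniq i j i<j)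
  (tri≈ _ i≡j _) → Finₚ.toℕ-injective i≡j
  (tri> _ _ j<i) → contradiction (sym eq) (allPairs-lookup uniq j i j<i)

length-filter-filter : ∀ {A : Set} {P Q : A → Set} (P? : Decidable P) (Q? : Decidable Q) xs →
                       length (filter P? (filter Q? xs)) ≤ length (filter P? xs)
length-filter-filter P? Q? [] = z≤n
length-filter-filter P? Q? (x ∷ xs) with Q? x
... | yes _ with P? x
...   | yes _ = s≤s (length-filter-filter P? Q? xs)
...   | no _  = length-filter-filter P? Q? xs
length-filter-filter P? Q? (x ∷ xs) | no _ with P? x
...   | yes _ = ℕₚ.m≤n⇒m≤1+n (length-filter-filter P? Q? xs)
...   | no _  = length-filter-filter P? Q? xs

other-keys : ∀ {A B : Set} (_≟_ : DecidableEquality B) (f : A → B) {key keys} xs → (∀ {a} → a ∈ xs → f a ∈ key ∷ keys) →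
             ∀ {a} → a ∈ filter (¬? ∘ λ a → f a ≟ key) xs → f a ∈ keys
other-keys _≟_ f {key} xs hit a∈ with a∈xs , fa≢key ← ∈-filter⁻ (¬? ∘ λ a → f a ≟ key) {xs = xs} a∈ with hit a∈xs
... | here eq  = contradiction eq fa≢key
... | there k∈ = k∈

-- Pigeonhole: if fewer than `m` elements have the first key, deleting them leaves more than `m`
-- times the number of remaining keys.
popular-key : ∀ {A B : Set} (_≟_ : DecidableEquality B) (f : A → B) m (keys : List B) xs →
              (∀ {a} → a ∈ xs → f a ∈ keys) → length keys * m < length xs →
              ∃[ key ] (m ≤ length (filter (λ a → f a ≟ key) xs))
popular-key _≟_ f m [] (x ∷ xs) hit _ with () ← hit (here refl)
popular-key _≟_ f m (key ∷ keys) xs hit many with m ℕ.≤? length (filter (λ a → f a ≟ key) xs)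
... | yes enough = key , enough
... | no few
  with key′ , enough ← popular-key _≟_ f m keys (filter (¬? ∘ λ a → f a ≟ key) xs) (other-keys _≟_ f xs hit)
         (ℕₚ.+-cancelˡ-< m _ _ (ℕₚ.<-≤-trans many (ℕₚ.≤-trans
           (ℕₚ.≤-reflexive (sym (length-filter-split (λ a → f a ≟ key) xs)))
           (ℕₚ.+-monoˡ-≤ _ (ℕₚ.<⇒≤ (ℕₚ.≰⇒> few))))))
  = key′ , ℕₚ.≤-trans enough (length-filter-filter (λ a → f a ≟ key′) (¬? ∘ λ a → f a ≟ key) xs)

words : ∀ K → ℕ → List (List (Fin K))
words K zero    = [] ∷ []
words K (suc j) = cartesianProductWith _∷_ (allFin K) (words K j)

∈-words : ∀ {K} xs {j} → length xs ≡ j → xs ∈ words K j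
∈-words []       refl = here refl
∈-words (x ∷ xs) refl = ∈-cartesianProductWith⁺ _∷_ (∈-allFin x) (∈-words xs refl)

-- Chordal orientations in which no vertex dominates a directed triangle.

Dominates : Arcs → (a b c w : ℕ) → Set
Dominates ρ a b c w = ρ w a ≡ true × ρ w b ≡ true × ρ w c ≡ true

undominated : Quadruple
undominated = record
  { Holds = λ ρ a b c w → ¬ Dominates ρ a b c w
  ; local = λ ag a< b< c< w< ¬dom (wa , wb , wc) →
      ¬dom (trans (ag w< a<) wa , trans (ag w< b<) wb , trans (ag w< c<) wc) }

-- A new vertex z completes L ⇒ R ⇒ z ⇒ L while dominating S.
module Rotation {ρ : Arcs} {z : ℕ} (asym : ∀ {u v} → ρ u v ≡ true → ρ v u ≡ true → ⊥)
                (L R S : List ℕ) (chain : AllPairs (λ u v → ρ u v ≡ true) (L ++ R ++ S))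
                (out : ∀ {v} → v ∈ L ++ S → ρ z v ≡ true) (inn : ∀ {v} → v ∈ R → ρ v z ≡ true) where

  into-new : ∀ {v} → v ∈ z ∷ (L ++ S) ++ R → ρ v z ≡ true → v ∈ R
  into-new (here refl) vz = ⊥-elim (asym vz vz)
  into-new (there v∈) vz with ∈-++⁻ (L ++ S) v∈
  ... | inj₁ v∈LS = ⊥-elim (asym vz (out v∈LS))
  ... | inj₂ v∈R  = v∈R

  out-of-new : ∀ {v} → v ∈ z ∷ (L ++ S) ++ R → ρ z v ≡ true → v ∈ L ++ S
  out-of-new (here refl) zv = ⊥-elim (asym zv zv)
  out-of-new (there v∈) zv with ∈-++⁻ (L ++ S) v∈
  ... | inj₁ v∈LS = v∈LS
  ... | inj₂ v∈R  = ⊥-elim (asym zv (inn v∈R))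

  -- Arcs into `z` come only from `R`, so `c` and `w` lie in `R`. If `b` is in `L` it precedes `w`,
  -- against w → b; if `b` is in `S` it comes after `c`, against b → c.
  triangle-at-new : ∀ {b c w} → b ∈ z ∷ (L ++ S) ++ R → c ∈ z ∷ (L ++ S) ++ R → w ∈ z ∷ (L ++ S) ++ R →
                    ρ z b ≡ true → ρ b c ≡ true → ρ c z ≡ true → ρ w z ≡ true → ρ w b ≡ true → ⊥
  triangle-at-new b∈ c∈ w∈ zb bc cz wz wb with ∈-++⁻ L (out-of-new b∈ zb)
  ... | inj₁ b∈L = asym wb (AllPairs-++⁻ L chain b∈L (∈-++⁺ˡ (into-new w∈ wz)))
  ... | inj₂ b∈S = asym bc (AllPairs-++⁻ R (AllPairs-resp-⊆ (Sublistₚ.++⁺ˡ L ⊆-refl) chain) (into-new c∈ cz) b∈S)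

  -- A triangle dominated by `z` would lie in the transitive `L ++ S`, and one avoiding `z` in the
  -- transitive chain, so neither exists; one through `z` is handled by `triangle-at-new`.
  not-dominated : ∀ {a b c w} → a ∈ z ∷ (L ++ S) ++ R → b ∈ z ∷ (L ++ S) ++ R → c ∈ z ∷ (L ++ S) ++ R →
                  w ∈ z ∷ (L ++ S) ++ R → ρ a b ≡ true → ρ b c ≡ true → ρ c a ≡ true → ¬ Dominates ρ a b c w
  not-dominated a∈ b∈ c∈ (here refl) ab bc ca (wa , wb , wc) =
    no-cyclic-triangle asym (AllPairs-resp-⊆ (Sublistₚ.++⁺ (⊆-refl {x = L}) (Sublistₚ.++⁺ˡ R ⊆-refl)) chain)
      (out-of-new a∈ wa) (out-of-new b∈ wb) (out-of-new c∈ wc) ab bc ca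
  not-dominated (here refl) b∈ c∈ w∈ ab bc ca (wa , wb , wc) = triangle-at-new b∈ c∈ w∈ ab bc ca wa wb
  not-dominated a∈ (here refl) c∈ w∈ ab bc ca (wa , wb , wc) = triangle-at-new c∈ a∈ w∈ bc ca ab wb wc
  not-dominated a∈ b∈ (here refl) w∈ ab bc ca (wa , wb , wc) = triangle-at-new a∈ b∈ w∈ ca ab bc wc wa
  not-dominated (there a∈) (there b∈) (there c∈) w∈ ab bc ca _ = no-cyclic-triangle asym chain (∈-++-rotate L R S a∈) (∈-++-rotate L R S b∈) (∈-++-rotate L R S c∈) ab bc ca

module UndominatedGame (K : ℕ) where
  open Game K undominated

  Chain : Board → List Coloured → Set
  Chain G T = AllPairs (λ u v → ρ G u v ≡ true) (map proj₁ T) × All (_< size G) (map proj₁ T)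

  chain-⊆ : ∀ {G S T} → S ⊆ T → Chain G T → Chain G S
  chain-⊆ τ (pairs , below) = AllPairs-resp-⊆ (Sublistₚ.map⁺ proj₁ τ) pairs , All-resp-⊆ (Sublistₚ.map⁺ proj₁ τ) below

  chain-mono : ∀ {G G′ T} → G ⊑ G′ → Chain G T → Chain G′ T
  chain-mono p (pairs , below) = AllPairs.map (arc-mono p) pairs , All.map (λ v< → ℕₚ.≤-trans v< (size-≤ p)) below

  chain-attachable : ∀ {G} L R S → AllPairs (λ u v → ρ G u v ≡ true) (L ++ R ++ S) → All (_< size G) (L ++ R ++ S) →
                     Attachable G (L ++ S) R
  chain-attachable {G} L R S chain all< = record
    { disjoint = disjoint
    ; below    = λ v∈ → All.lookup all< (∈-++-rotate L R S v∈)
    ; clique   = λ u∈ v∈ → AllPairs-total chain (∈-++-rotate L R S u∈) (∈-++-rotate L R S v∈)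
    ; new-quad = λ z≥ ag asym′ out inn a∈ b∈ c∈ w∈ ab bc ca _ _ _ →
        Rotation.not-dominated asym′ L R S (lift-chain ag chain all<) out inn a∈ b∈ c∈ w∈ ab bc ca
    }
    where
    lift-chain : ∀ {ρ′ vs} → Agree (size G) (ρ G) ρ′ → AllPairs (λ u v → ρ G u v ≡ true) vs → All (_< size G) vs →
                 AllPairs (λ u v → ρ′ u v ≡ true) vs
    lift-chain ag [] [] = []
    lift-chain ag (r ∷ rs) (v< ∷ vs<) = All.tabulate (λ w∈ → trans (sym (ag v< (All.lookup vs< w∈))) (All.lookup r w∈)) ∷ lift-chain ag rs vs<

    disjoint : ∀ {v} → v ∈ L ++ S → v ∈ R → ⊥
    disjoint v∈LS v∈R with ∈-++⁻ L v∈LS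
    ... | inj₁ v∈L = let vv = AllPairs-++⁻ L chain v∈L (∈-++⁺ˡ v∈R) in asym G vv vv
    ... | inj₂ v∈S = let vv = AllPairs-++⁻ R (AllPairs-resp-⊆ (Sublistₚ.++⁺ˡ L ⊆-refl) chain) v∈R v∈S in asym G vv vv

  Rich : List (Fin K) → List Coloured → Set
  Rich D B = ∀ {x} → x ∈ D → ∃[ v ] ((v , x) ∈ B)

  -- After the move, `z` precedes `L ++ S` in a transitive tournament that has lost `R`. The colours
  -- of `R` stay among the commitments, since a vertex of `R` may complete a monochromatic triangle
  -- with `z`.
  rotate : ∀ {G} L R S → Chain G (L ++ R ++ S) →
           (∀ G′ z x → G ⊑ G′ → Chain G′ ((z , x) ∷ L ++ S) → (∀ {p} → p ∈ R → ρ G′ (proj₁ p) z ≡ true) →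
              Win G′ ((z , x) ∷ L ++ R ++ S)) →
           Win G (L ++ R ++ S)
  rotate {G} L R S chain play = attach att λ G′ z p z≥ z< out inn x →
    play G′ z x p (All.tabulate (λ v∈ → out (subst (_ ∈_) (map-++ proj₁ L S) v∈)) ∷ proj₁ (old-chain p) , z< ∷ proj₂ (old-chain p))
      (inn ∘ ∈-map⁺ proj₁)
    where
    split : map proj₁ (L ++ R ++ S) ≡ map proj₁ L ++ map proj₁ R ++ map proj₁ S
    split = trans (map-++ proj₁ L (R ++ S)) (cong (map proj₁ L ++_) (map-++ proj₁ R S))

    att : Attachable G (map proj₁ L ++ map proj₁ S) (map proj₁ R)
    att = chain-attachable (map proj₁ L) (map proj₁ R) (map proj₁ S)
            (subst (AllPairs _) split (proj₁ chain)) (subst (All _) split (proj₂ chain))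

    old-chain : ∀ {G′} → G ⊑ G′ → Chain G′ (L ++ S)
    old-chain p = chain-mono p (chain-⊆ {G} (Sublistₚ.++⁺ (⊆-refl {x = L}) (Sublistₚ.++⁺ˡ R ⊆-refl)) chain)

  _∈?_ : ∀ x (D : List (Fin K)) → Dec (x ∈ D)
  x ∈? D = any? (x Fin.≟_) D

  -- Every answer in `D` that is new to `L` turns one block into an element of `L`, preserving
  -- `length L + length Bs`. The colours of `L` are distinct, so at least two blocks always remain:
  -- one for the next move and one to accompany the new colour.
  NewColour : List Coloured → List (Fin K) → List (List Coloured) → Set
  NewColour T D Bs = ∀ {G} L → Chain G (L ++ concat Bs ++ T) → Unique (map proj₂ L) → 2 + K ≤ length L + length Bs →
    (∀ G′ z x B → G ⊑ G′ → x ∉ D → Rich D B → Chain G′ ((z , x) ∷ B ++ T) → Win G′ ((z , x) ∷ B ++ T)) →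
    Win G (L ++ concat Bs ++ T)

  -- Each reply in D enlarges the set of colours of L, so eventually the reply is outside D.
  new-colour : ∀ T D Bs → All (Rich D) Bs → NewColour T D Bs
  new-colour T D [] rich L chain uniq enough play =
    ⊥-elim (ℕₚ.<⇒≱ (ℕₚ.n≤1+n (suc K)) (ℕₚ.≤-trans enough (ℕₚ.≤-trans (ℕₚ.≤-reflexive (trans (ℕₚ.+-identityʳ _) (sym (length-map proj₂ L)))) (unique-length uniq))))
  new-colour T D (R ∷ []) rich L chain uniq enough play =
    ⊥-elim (ℕₚ.<⇒≱ (ℕₚ.n<1+n K) (ℕₚ.≤-pred (ℕₚ.≤-trans enough (ℕₚ.≤-trans (ℕₚ.≤-reflexive (trans (ℕₚ.+-comm _ 1) (cong suc (sym (length-map proj₂ L))))) (s≤s (unique-length uniq))))))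
  new-colour T D (R ∷ B ∷ Bs) (richR ∷ richB ∷ richBs) {G} L chain uniq enough play =
    subst (λ Γ → Win G (L ++ Γ)) (sym (++-assoc R (concat (B ∷ Bs)) T)) (rotate L R S chain′ (reply (new-colour T D (B ∷ Bs) (richB ∷ richBs))))
    where
    S : List Coloured
    S = concat (B ∷ Bs) ++ T

    chain′ : Chain G (L ++ R ++ S)
    chain′ = subst (λ Γ → Chain G (L ++ Γ)) (++-assoc R (concat (B ∷ Bs)) T) chain

    B++T⊆S : B ++ T ⊆ S
    B++T⊆S = Sublistₚ.++⁺ (Sublistₚ.++⁺ʳ (concat Bs) (⊆-refl {x = B})) ⊆-refl

    reply : NewColour T D (B ∷ Bs) → ∀ G′ z x → G ⊑ G′ → Chain G′ ((z , x) ∷ L ++ S) → (∀ {p} → p ∈ R → ρ G′ (proj₁ p) z ≡ true) →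
            Win G′ ((z , x) ∷ L ++ R ++ S)
    reply ih G′ z x p chain-z inn with x ∈? D
    ... | no x∉D = win-weaken (Sublist.lookup (refl ∷ Sublistₚ.++⁺ˡ L (Sublistₚ.++⁺ˡ R B++T⊆S)))
                     (play G′ z x B p x∉D richB (chain-⊆ {G′} (refl {x = z , x} ∷ Sublistₚ.++⁺ˡ L B++T⊆S) chain-z))
    ... | yes x∈D with x ∈? map proj₂ L
    ...   | no x∉L = win-weaken (Sublist.lookup (refl ∷ Sublistₚ.++⁺ (⊆-refl {x = L}) (Sublistₚ.++⁺ˡ R ⊆-refl)))
                       (ih ((z , x) ∷ L) chain-z (All.tabulate (λ y∈ x≡y → x∉L (subst (_∈ _) (sym x≡y) y∈)) ∷ uniq)
                         (ℕₚ.≤-trans enough (ℕₚ.≤-reflexive (ℕₚ.+-suc (length L) _)))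
                         λ G″ z′ x′ B′ q → play G″ z′ x′ B′ (⊑-trans p q))
    -- Here z → l → r → z is monochromatic, where l in `L` has colour `x` and r is a vertex of that
    -- colour in the rich block `R`.
    ...   | yes x∈L
      with (l , _) , l∈L , refl ← ∈-map⁻ proj₂ x∈L
      with r , r∈R ← richR x∈D =
      win-triangle
        (All.lookup (AllPairs.head (proj₁ chain-z)) (∈-map⁺ proj₁ (∈-++⁺ˡ l∈L)))
        (AllPairs-++⁻ L (AllPairsₚ.map⁻ (proj₁ (chain-mono p chain′))) l∈L (∈-++⁺ˡ r∈R))
        (inn r∈R)
        (here refl) (there (∈-++⁺ˡ l∈L)) (there (∈-++⁺ʳ L (∈-++⁺ˡ r∈R)))

  -- Plays strictly in front of an arbitrary given chain T, so that all of T is still available afterwards.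
  Force : ℕ → Set
  Force j = ∀ m {G T} → Chain G T →
    (∀ G′ D Bs → G ⊑ G′ → length D ≡ j → Unique D → length Bs ≡ m → All (Rich D) Bs →
       Chain G′ (concat Bs ++ T) → Win G′ (concat Bs ++ T)) →
    Win G T

  Block : Set
  Block = List (Fin K) × List Coloured

  Full : ℕ → Block → Set
  Full j (D , B) = length D ≡ j × Unique D × Rich D B

  -- Each round plays in front of the blocks already obtained, treating them as part of the fixed
  -- chain, and adds one block with a new colour to `acc`.
  collect : ∀ {j} → Force j → ∀ N acc {G T} → All (Full (suc j)) acc → Chain G (concat (map proj₂ acc) ++ T) →
            (∀ G′ Es → G ⊑ G′ → length Es ≡ N + length acc → All (Full (suc j)) Es →
               Chain G′ (concat (map proj₂ Es) ++ T) → Win G′ (concat (map proj₂ Es) ++ T)) →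
            Win G (concat (map proj₂ acc) ++ T)
  collect force zero acc full chain play = play _ acc ⊑-refl refl full chain
  collect force (suc N) acc {G} {T} full chain play =
    -- `new-colour` starts with empty `L`, so it needs `2 + K` blocks.
    force (2 + K) chain λ G₁ D Bs p len uniq count rich chain₁ →
    new-colour (concat (map proj₂ acc) ++ T) D Bs rich [] chain₁ [] (ℕₚ.≤-reflexive (sym count)) λ G₂ z x B q x∉D richB chain₂ →
    subst (Win G₂) (++-assoc ((z , x) ∷ B) (concat (map proj₂ acc)) T)
      (collect force N ((x ∷ D , (z , x) ∷ B) ∷ acc)
        ((cong suc len , All.tabulate (λ y∈ x≡y → x∉D (subst (_∈ D) (sym x≡y) y∈)) ∷ uniq ,
          λ { (here refl) → z , here refl ; (there y∈) → proj₁ (richB y∈) , there (proj₂ (richB y∈)) }) ∷ full)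
        (subst (Chain G₂) (sym (++-assoc ((z , x) ∷ B) (concat (map proj₂ acc)) T)) chain₂)
        λ G₃ Es r count′ → play G₃ Es (⊑-trans p (⊑-trans q r)) (trans count′ (ℕₚ.+-suc N (length acc))))

  force : ∀ j → Force j
  force zero m {G} {T} chain play =
    subst (λ Γ → Win G (Γ ++ T)) (concat-empty m)
      (play G [] (replicate m []) ⊑-refl refl [] (length-replicate m) (Allₚ.replicate⁺ m λ ())
        (subst (λ Γ → Chain G (Γ ++ T)) (sym (concat-empty m)) chain))
    where
    concat-empty : ∀ m → concat {A = Coloured} (replicate m []) ≡ []
    concat-empty zero    = refl
    concat-empty (suc m) = concat-empty m
  force (suc j) m {G} {T} chain play =
    -- Some `D` then belongs to at least `suc m` of the blocks. Only `m` are handed on; the extra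
    -- one provides a block from which the properties of `D` can be read off even if `m` is 0.
    collect (force j) (suc (length (words K (suc j)) * suc m)) [] [] chain select
    where
    _≟ᴰ_ : DecidableEquality (List (Fin K))
    _≟ᴰ_ = ≡-dec Fin._≟_

    module Selection (Es : List Block) (D : List (Fin K)) (full : All (Full (suc j)) Es)
                     (enough : suc m ≤ length (filter (λ E → proj₁ E ≟ᴰ D) Es)) where
      chosen : List Block
      chosen = take m (filter (λ E → proj₁ E ≟ᴰ D) Es)

      count : length (map proj₂ chosen) ≡ m
      count = trans (length-map proj₂ chosen) (trans (length-take m _) (ℕₚ.m≤n⇒m⊓n≡m (ℕₚ.<⇒≤ enough)))

      Γ⊆ : concat (map proj₂ chosen) ++ T ⊆ concat (map proj₂ Es) ++ T
      Γ⊆ = Sublistₚ.++⁺ (Sublistₚ.concat⁺ (Hetero.map ⊆-reflexive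
             (Sublistₚ.map⁺ proj₂ (⊆-trans (take-⊆ m _) (filter-⊆ (λ E → proj₁ E ≟ᴰ D) Es))))) ⊆-refl

      full-D : ∀ {E} → E ∈ filter (λ E → proj₁ E ≟ᴰ D) Es → Full (suc j) (D , proj₂ E)
      full-D E∈ with E∈Es , refl ← ∈-filter⁻ (λ E → proj₁ E ≟ᴰ D) {xs = Es} E∈ = All.lookup full E∈Es

      rich : All (Rich D) (map proj₂ chosen)
      rich = Allₚ.map⁺ (All.tabulate λ E∈ → proj₂ (proj₂ (full-D (Sublist.lookup (take-⊆ m _) E∈))))

      length×unique : length D ≡ suc j × Unique D
      length×unique = read-off _ enough full-D
        where
        read-off : ∀ Fs → suc m ≤ length Fs → (∀ {E} → E ∈ Fs → Full (suc j) (D , proj₂ E)) → length D ≡ suc j × Unique D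
        read-off (_ ∷ _) _ full′ = proj₁ (full′ (here refl)) , proj₁ (proj₂ (full′ (here refl)))

    select : ∀ G′ Es → G ⊑ G′ → length Es ≡ suc (length (words K (suc j)) * suc m) + 0 → All (Full (suc j)) Es →
             Chain G′ (concat (map proj₂ Es) ++ T) → Win G′ (concat (map proj₂ Es) ++ T)
    select G′ Es p many full chain′
      with D , enough ← popular-key _≟ᴰ_ proj₁ (suc m) (words K (suc j)) Es
             (λ E∈ → ∈-words _ (proj₁ (All.lookup full E∈)))
             (ℕₚ.≤-reflexive (sym (trans many (ℕₚ.+-identityʳ _))))
      = win-weaken (Sublist.lookup Γ⊆) (play G′ D (map proj₂ chosen) p (proj₁ length×unique) (proj₂ length×unique)
          count rich (chain-⊆ {G′} Γ⊆ chain′))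
      where open Selection Es D full enough

  win : Win empty []
  -- No blocks are requested: `D` alone would consist of K + 1 distinct colours.
  win = force (suc K) 0 ([] , []) λ _ D _ _ len uniq _ _ _ →
    ⊥-elim (ℕₚ.<⇒≱ (ℕₚ.n<1+n K) (subst (_≤ K) len (unique-length uniq)))

  winning-position : ∃[ G ] (∀ c → MonoTriangle G c)
  winning-position = winning-board win

-- Chordal orientations from nested monochromatic arcs.

Nested : Arcs → (a b c w : ℕ) → Set
-- Labels are times of arrival, so `c` is the last vertex of the triangle, and the third alternative
-- says that `w` lies with respect to a → b as `c` does.
Nested ρ a b c w = a < c → b < c →
  Dominates ρ a b c w ⊎ (ρ a w ≡ true × ρ b w ≡ true × ρ c w ≡ true) ⊎ (ρ b w ≡ true × ρ w a ≡ true)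

nested : Quadruple
nested = record { Holds = Nested ; local = local }
  where
  local : ∀ {m ρ ρ′} → Agree m ρ ρ′ → ∀ {a b c w} → a < m → b < m → c < m → w < m → Nested ρ a b c w → Nested ρ′ a b c w
  local ag a< b< c< w< holds a<c b<c with holds a<c b<c
  ... | inj₁ (wa , wb , wc) = inj₁ (trans (sym (ag w< a<)) wa , trans (sym (ag w< b<)) wb , trans (sym (ag w< c<)) wc)
  ... | inj₂ (inj₁ (aw , bw , cw)) = inj₂ (inj₁ (trans (sym (ag a< w<)) aw , trans (sym (ag b< w<)) bw , trans (sym (ag c< w<)) cw))
  ... | inj₂ (inj₂ (bw , wa)) = inj₂ (inj₂ (trans (sym (ag b< w<)) bw , trans (sym (ag w< a<)) wa))

-- Monochromatic arcs u → v such that all later vertices t satisfy v → t → u,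
-- followed by a transitive tournament, which is listed from its sink to its source.
module NestedGame (k : ℕ) where

  K : ℕ
  K = suc k

  open Game K nested

  record Pair : Set where
    constructor pair
    field
      tail head : ℕ
      colour    : Fin K
  open Pair

  data Vertex : List Pair → List Coloured → ℕ → Set where
    is-tail : ∀ {q ps xs} → Vertex (q ∷ ps) xs (tail q)
    is-head : ∀ {q ps xs} → Vertex (q ∷ ps) xs (head q)
    deeper  : ∀ {q ps xs w} → Vertex ps xs w → Vertex (q ∷ ps) xs w
    tip     : ∀ {xs w} → w ∈ map proj₁ xs → Vertex [] xs w

  record Inner (ρ : Arcs) (q : Pair) (w : ℕ) : Set where
    constructor inner
    field
      tail< : tail q < w
      head< : head q < w
      from  : ρ (head q) w ≡ true
      to    : ρ w (tail q) ≡ true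
  open Inner

  data Stack (ρ : Arcs) : List Pair → List Coloured → Set where
    chain : ∀ {xs} → AllPairs (λ u v → ρ v u ≡ true) (map proj₁ xs) → Stack ρ [] xs
    push  : ∀ {q ps xs} → ρ (tail q) (head q) ≡ true → (∀ {w} → Vertex ps xs w → Inner ρ q w) → Stack ρ ps xs → Stack ρ (q ∷ ps) xs

  module _ {ρ : Arcs} where

    stack-adjacent : ∀ {ps xs} → Stack ρ ps xs → ∀ {u v} → Vertex ps xs u → Vertex ps xs v → u ≢ v → Adj ρ u v
    stack-adjacent (chain ch) (tip u∈) (tip v∈) u≢v = swap (AllPairs-total ch u∈ v∈ u≢v)
    stack-adjacent (push uv ins st) is-tail is-tail ne = contradiction refl ne
    stack-adjacent (push uv ins st) is-tail is-head ne = inj₁ uv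
    stack-adjacent (push uv ins st) is-tail (deeper w) ne = inj₂ (to (ins w))
    stack-adjacent (push uv ins st) is-head is-tail ne = inj₂ uv
    stack-adjacent (push uv ins st) is-head is-head ne = contradiction refl ne
    stack-adjacent (push uv ins st) is-head (deeper w) ne = inj₁ (from (ins w))
    stack-adjacent (push uv ins st) (deeper w) is-tail ne = inj₁ (to (ins w))
    stack-adjacent (push uv ins st) (deeper w) is-head ne = inj₂ (from (ins w))
    stack-adjacent (push uv ins st) (deeper w) (deeper w′) ne = stack-adjacent st w w′ ne

    module _ (asym : ∀ {u v} → ρ u v ≡ true → ρ v u ≡ true → ⊥) where

      -- Vertices deeper than the outermost pair come from its head and go into its tail, so no
      -- directed triangle consists of one vertex of the pair and two deeper ones. A triangle using
      -- both has them as `a` and `b`, since `c` arrived last, and a deeper `w` satisfies b → w → a.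
      -- A deeper triangle is dominated by the head and dominates the tail; any other `w` is left to
      -- the recursion.
      stack-nested : ∀ {ps xs} → Stack ρ ps xs → ∀ {a b c w} →
        Vertex ps xs a → Vertex ps xs b → Vertex ps xs c → Vertex ps xs w →
        ρ a b ≡ true → ρ b c ≡ true → ρ c a ≡ true → Adj ρ w a → Adj ρ w b → Nested ρ a b c w
      stack-nested (chain ch) (tip a∈) (tip b∈) (tip c∈) w ab bc ca _ _ _ _ =
        ⊥-elim (no-cyclic-triangle (λ p q → asym q p) ch b∈ a∈ c∈ ab ca bc)
      stack-nested (push uv ins st) is-tail is-tail c w ab bc ca _ _ _ _ = ⊥-elim (asym ab ab)
      stack-nested (push uv ins st) is-head is-head c w ab bc ca _ _ _ _ = ⊥-elim (asym ab ab)
      stack-nested (push uv ins st) (deeper a) b is-tail w ab bc ca _ _ a<c _ = ⊥-elim (ℕₚ.<-asym a<c (tail< (ins a)))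
      stack-nested (push uv ins st) (deeper a) b is-head w ab bc ca _ _ a<c _ = ⊥-elim (ℕₚ.<-asym a<c (head< (ins a)))
      stack-nested (push uv ins st) a (deeper b) is-tail w ab bc ca _ _ _ b<c = ⊥-elim (ℕₚ.<-asym b<c (tail< (ins b)))
      stack-nested (push uv ins st) a (deeper b) is-head w ab bc ca _ _ _ b<c = ⊥-elim (ℕₚ.<-asym b<c (head< (ins b)))
      stack-nested (push uv ins st) is-tail is-head is-tail w ab bc ca _ _ _ _ = ⊥-elim (asym ca ca)
      stack-nested (push uv ins st) is-tail is-head is-head w ab bc ca _ _ _ _ = ⊥-elim (asym bc bc)
      stack-nested (push uv ins st) is-head is-tail is-tail w ab bc ca _ _ _ _ = ⊥-elim (asym bc bc)
      stack-nested (push uv ins st) is-head is-tail is-head w ab bc ca _ _ _ _ = ⊥-elim (asym ca ca)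
      stack-nested (push uv ins st) is-tail is-head (deeper c) is-tail ab bc ca wa _ _ _ = ⊥-elim ([ (λ p → asym p p) , (λ p → asym p p) ]′ wa)
      stack-nested (push uv ins st) is-tail is-head (deeper c) is-head ab bc ca _ wb _ _ = ⊥-elim ([ (λ p → asym p p) , (λ p → asym p p) ]′ wb)
      stack-nested (push uv ins st) is-tail is-head (deeper c) (deeper w) ab bc ca _ _ _ _ = inj₂ (inj₂ (from (ins w) , to (ins w)))
      stack-nested (push uv ins st) is-tail (deeper b) (deeper c) w ab bc ca _ _ _ _ = ⊥-elim (asym ab (to (ins b)))
      stack-nested (push uv ins st) is-head b (deeper c) w ab bc ca _ _ _ _ = ⊥-elim (asym ca (from (ins c)))
      stack-nested (push uv ins st) (deeper a) is-tail (deeper c) w ab bc ca _ _ _ _ = ⊥-elim (asym bc (to (ins c)))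
      stack-nested (push uv ins st) (deeper a) is-head (deeper c) w ab bc ca _ _ _ _ = ⊥-elim (asym ab (from (ins a)))
      stack-nested (push uv ins st) (deeper a) (deeper b) (deeper c) is-tail ab bc ca _ _ _ _ =
        inj₂ (inj₁ (to (ins a) , to (ins b) , to (ins c)))
      stack-nested (push uv ins st) (deeper a) (deeper b) (deeper c) is-head ab bc ca _ _ _ _ =
        inj₁ (from (ins a) , from (ins b) , from (ins c))
      stack-nested (push uv ins st) (deeper a) (deeper b) (deeper c) (deeper w) ab bc ca wa wb a<c b<c =
        stack-nested st a b c w ab bc ca wa wb a<c b<c

  tails heads : List Pair → List ℕ
  tails = map tail
  heads = map head

  vertex-tail : ∀ {ps xs w} → w ∈ tails ps → Vertex ps xs w
  vertex-tail {_ ∷ _} (here refl) = is-tail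
  vertex-tail {_ ∷ _} (there w∈)  = deeper (vertex-tail w∈)

  vertex-in : ∀ ps {xs w} → w ∈ heads ps ++ map proj₁ xs → Vertex ps xs w
  vertex-in []       w∈          = tip w∈
  vertex-in (_ ∷ ps) (here refl) = is-head
  vertex-in (_ ∷ ps) (there w∈)  = deeper (vertex-in ps w∈)

  vertex : ∀ {ps xs w} → w ∈ tails ps ++ heads ps ++ map proj₁ xs → Vertex ps xs w
  vertex {ps} w∈ with ∈-++⁻ (tails ps) w∈
  ... | inj₁ w∈ₜ = vertex-tail w∈ₜ
  ... | inj₂ w∈ₕ = vertex-in ps w∈ₕ

  vertex-extend : ∀ {ps xs y w} → Vertex ps xs w → Vertex ps (y ∷ xs) w
  vertex-extend is-tail    = is-tail
  vertex-extend is-head    = is-head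
  vertex-extend (deeper w) = deeper (vertex-extend w)
  vertex-extend (tip w∈)   = tip (there w∈)

  vertex-new : ∀ ps {xs z x} → Vertex ps ((z , x) ∷ xs) z
  vertex-new []       = tip (here refl)
  vertex-new (q ∷ ps) = deeper (vertex-new ps)

  vertex-cases : ∀ {ps xs y w} → Vertex ps (y ∷ xs) w → w ≡ proj₁ y ⊎ Vertex ps xs w
  vertex-cases is-tail = inj₂ is-tail
  vertex-cases is-head = inj₂ is-head
  vertex-cases (deeper w) with vertex-cases w
  ... | inj₁ eq = inj₁ eq
  ... | inj₂ w′ = inj₂ (deeper w′)
  vertex-cases (tip (here refl)) = inj₁ refl
  vertex-cases (tip (there w∈))  = inj₂ (tip w∈)

  stack-lift : ∀ {m ρ ρ′ ps xs} → Agree m ρ ρ′ → (∀ {w} → Vertex ps xs w → w < m) → Stack ρ ps xs → Stack ρ′ ps xs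
  stack-lift {m} {ρ} {ρ′} ag below (chain ch) = chain (lift ch (below ∘ tip))
    where
    lift : ∀ {vs} → AllPairs (λ u v → ρ v u ≡ true) vs → (∀ {w} → w ∈ vs → w < m) → AllPairs (λ u v → ρ′ v u ≡ true) vs
    lift [] below = []
    lift (r ∷ rs) below = All.tabulate (λ w∈ → trans (sym (ag (below (there w∈)) (below (here refl)))) (All.lookup r w∈)) ∷ lift rs (below ∘ there)
  stack-lift ag below (push uv ins st) = push (trans (sym (ag (below is-tail) (below is-head))) uv)
    (λ w → inner (tail< (ins w)) (head< (ins w))
             (trans (sym (ag (below is-head) (below (deeper w)))) (from (ins w)))
             (trans (sym (ag (below (deeper w)) (below is-tail))) (to (ins w))))
    (stack-lift ag (below ∘ deeper) st)

  stack-add : ∀ {ρ ps xs z x} → (∀ {w} → w ∈ tails ps → ρ z w ≡ true) → (∀ {w} → w ∈ heads ps ++ map proj₁ xs → ρ w z ≡ true) →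
              (∀ {w} → Vertex ps xs w → w < z) → Stack ρ ps xs → Stack ρ ps ((z , x) ∷ xs)
  stack-add out inn below (chain ch) = chain (All.tabulate inn ∷ ch)
  stack-add {ρ} {q ∷ ps} {xs} {z} {x} out inn below (push uv ins st) =
    push uv ins′ (stack-add (out ∘ there) (inn ∘ there) (below ∘ deeper) st)
    where
    ins′ : ∀ {w} → Vertex ps ((z , x) ∷ xs) w → Inner ρ q w
    ins′ w with vertex-cases w
    ... | inj₁ refl = inner (below is-tail) (below is-head) (inn (here refl)) (out (here refl))
    ... | inj₂ w′   = ins w′

  vertex-close : ∀ {ps xs z y c w} → y ∈ map proj₁ xs → Vertex (ps ++ pair y z c ∷ []) [] w → Vertex ps ((z , c) ∷ xs) w
  vertex-close {[]} y∈ is-tail = tip (there y∈)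
  vertex-close {[]} y∈ is-head = tip (here refl)
  vertex-close {[]} y∈ (deeper (tip ()))
  vertex-close {_ ∷ _} y∈ is-tail = is-tail
  vertex-close {_ ∷ _} y∈ is-head = is-head
  vertex-close {_ ∷ _} y∈ (deeper w) = deeper (vertex-close y∈ w)

  -- As the sink of the tip, `z` receives an arc from `y`; y → z becomes the innermost pair and the
  -- rest of the tip is given up.
  stack-close : ∀ {ρ ps xs z y c} → y ∈ map proj₁ xs → Stack ρ ps ((z , c) ∷ xs) → Stack ρ (ps ++ pair y z c ∷ []) []
  stack-close y∈ (chain (r ∷ ch)) = push (All.lookup r y∈) (λ { (tip ()) }) (chain [])
  stack-close y∈ (push uv ins st) = push uv (ins ∘ vertex-close y∈) (stack-close y∈ st)

  commitments : List Pair → List Coloured → List Coloured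
  commitments []                xs = xs
  commitments (pair u v c ∷ ps) xs = (u , c) ∷ (v , c) ∷ commitments ps xs

  commitments-add : ∀ ps {xs y p} → p ∈ commitments ps (y ∷ xs) → p ∈ y ∷ commitments ps xs
  commitments-add [] p∈ = p∈
  commitments-add (_ ∷ ps) (here refl) = there (here refl)
  commitments-add (_ ∷ ps) (there (here refl)) = there (there (here refl))
  commitments-add (_ ∷ ps) (there (there p∈)) with commitments-add ps p∈
  ... | here eq = here eq
  ... | there p∈′ = there (there (there p∈′))

  commitments-close : ∀ ps {xs z y c p} → (y , c) ∈ xs → p ∈ commitments (ps ++ pair y z c ∷ []) [] → p ∈ commitments ps ((z , c) ∷ xs)
  commitments-close [] y∈ (here refl) = there y∈
  commitments-close [] y∈ (there (here refl)) = here refl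
  commitments-close (_ ∷ ps) y∈ (here refl) = here refl
  commitments-close (_ ∷ ps) y∈ (there (here refl)) = there (here refl)
  commitments-close (_ ∷ ps) y∈ (there (there p∈)) = there (there (commitments-close ps y∈ p∈))

  commitments-pair : ∀ {ps xs q} → q ∈ ps → (tail q , colour q) ∈ commitments ps xs × (head q , colour q) ∈ commitments ps xs
  commitments-pair (here refl) = here refl , there (here refl)
  commitments-pair (there q∈) with p , p′ ← commitments-pair q∈ = there (there p) , there (there p′)

  stack-pair : ∀ {ρ ps xs q} → Stack ρ ps xs → q ∈ ps → ρ (tail q) (head q) ≡ true
  stack-pair (push uv ins st) (here refl) = uv
  stack-pair (push uv ins st) (there q∈)  = stack-pair st q∈

  stack-attachable : ∀ {G ps xs} → Stack (ρ G) ps xs → (∀ {w} → Vertex ps xs w → w < size G) →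
                     Attachable G (tails ps) (heads ps ++ map proj₁ xs)
  stack-attachable {G} {ps} {xs} st below = record
    { disjoint = disjoint st
    ; below    = below ∘ vertex
    ; clique   = λ u∈ v∈ → stack-adjacent st (vertex u∈) (vertex v∈)
    ; new-quad = λ z≥ ag asym′ out inn a∈ b∈ c∈ w∈ ab bc ca wa wb wc →
        stack-nested asym′ (stack-add {x = zero} out inn (λ w → ℕₚ.<-≤-trans (below w) z≥) (stack-lift ag below st))
          (vertex′ a∈) (vertex′ b∈) (vertex′ c∈) (vertex′ w∈) ab bc ca wa wb
    }
    where
    vertex′ : ∀ {z w} → w ∈ z ∷ tails ps ++ heads ps ++ map proj₁ xs → Vertex ps ((z , zero) ∷ xs) w
    vertex′ (here refl) = vertex-new ps
    vertex′ (there w∈)  = vertex-extend (vertex w∈)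

    disjoint : ∀ {ps xs} → Stack (ρ G) ps xs → ∀ {v} → v ∈ tails ps → v ∈ heads ps ++ map proj₁ xs → ⊥
    disjoint (push uv ins st) (here refl) (here eq) =
      let uu = subst (λ v → ρ G _ v ≡ true) (sym eq) uv in asym G uu uu
    disjoint {_ ∷ ps} (push uv ins st) (here refl) (there v∈) = ℕₚ.<-irrefl refl (tail< (ins (vertex-in ps v∈)))
    disjoint (push uv ins st) (there v∈) (here refl) = ℕₚ.<-irrefl refl (head< (ins (vertex-tail v∈)))
    disjoint (push uv ins st) (there v∈) (there v∈′) = disjoint st v∈ v∈′

  -- The pairs have distinct colours, and so have the vertices of the tip, so neither list exceeds
  -- `K`. Hence `f` and `g` bound how often each can still grow.
  Play : ℕ → ℕ → Set
  Play f g = ∀ {G ps xs} → Stack (ρ G) ps xs → (∀ {w} → Vertex ps xs w → w < size G) →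
    Unique (map colour ps) → Unique (map proj₂ xs) → K < f + length ps → K < g + length xs →
    Win G (commitments ps xs)

  -- If the answer is the colour of a pair, that pair and `z` form a monochromatic triangle. If it
  -- is the colour of a tip vertex y, the arc y → z becomes a new pair and the tip starts afresh
  -- with budget `suc K`. Otherwise the tip grows.
  play-step : ∀ {f g} → Play f (suc K) → Play (suc f) g → Play (suc f) (suc g)
  play-step {f} {g} play-closed play-longer {G} {ps} {xs} st below uniq-ps uniq-xs f> g> = attach (stack-attachable st below) reply
    where
    reply : ∀ G′ z → G ⊑ G′ → size G ≤ z → z < size G′ →
            (∀ {v} → v ∈ tails ps → ρ G′ z v ≡ true) → (∀ {v} → v ∈ heads ps ++ map proj₁ xs → ρ G′ v z ≡ true) →
            ∀ x → Win G′ ((z , x) ∷ commitments ps xs)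
    reply G′ z p z≥ z< out inn x = respond (any? (x Fin.≟_) (map colour ps)) (any? (x Fin.≟_) (map proj₂ xs))
      where
      st₀ : Stack (ρ G′) ps xs
      st₀ = stack-lift (agree p) below st

      st′ : Stack (ρ G′) ps ((z , x) ∷ xs)
      st′ = stack-add out inn (λ w → ℕₚ.<-≤-trans (below w) z≥) st₀

      below′ : ∀ {w} → Vertex ps ((z , x) ∷ xs) w → w < size G′
      below′ w = [ (λ { refl → z< }) , (λ w′ → ℕₚ.<-≤-trans (below w′) (size-≤ p)) ]′ (vertex-cases w)

      respond : Dec (x ∈ map colour ps) → Dec (x ∈ map proj₂ xs) → Win G′ ((z , x) ∷ commitments ps xs)
      respond (yes x∈ps) _ with q , q∈ , refl ← ∈-map⁻ colour x∈ps =
        win-triangle (stack-pair st₀ q∈) (inn (∈-++⁺ˡ (∈-map⁺ head q∈))) (out (∈-map⁺ tail q∈))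
          (there (proj₁ (commitments-pair q∈))) (there (proj₂ (commitments-pair q∈))) (here refl)
      respond (no x∉ps) (yes x∈xs) with (y , _) , y∈ , refl ← ∈-map⁻ proj₂ x∈xs =
        win-weaken (commitments-add ps ∘ commitments-close ps y∈)
          (play-closed (stack-close (∈-map⁺ proj₁ y∈) st′) (below′ ∘ vertex-close (∈-map⁺ proj₁ y∈))
            (subst Unique (sym (map-++ colour ps _)) (AllPairsₚ.++⁺ uniq-ps ([] ∷ [])
              (All.tabulate λ c∈ → (λ c≡x → x∉ps (subst (_∈ _) c≡x c∈)) ∷ [])))
            [] (ℕₚ.≤-trans f> (ℕₚ.≤-reflexive (trans (sym (ℕₚ.+-suc f (length ps)))
              (cong (f +_) (trans (ℕₚ.+-comm 1 (length ps)) (sym (length-++ ps))))))) (ℕₚ.m≤m+n (suc K) 0))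
      respond (no x∉ps) (no x∉xs) = win-weaken (commitments-add ps)
        (play-longer st′ below′ uniq-ps (All.tabulate (λ c∈ x≡c → x∉xs (subst (_∈ _) (sym x≡c) c∈)) ∷ uniq-xs)
          f> (ℕₚ.≤-trans g> (ℕₚ.≤-reflexive (sym (ℕₚ.+-suc g (length xs))))))

  play : ∀ f g → Play f g
  play zero g {ps = ps} st below uniq-ps uniq-xs f> g> =
    ⊥-elim (ℕₚ.<⇒≱ f> (subst (_≤ K) (length-map colour ps) (unique-length uniq-ps)))
  play (suc f) zero {xs = xs} st below uniq-ps uniq-xs f> g> =
    ⊥-elim (ℕₚ.<⇒≱ g> (subst (_≤ K) (length-map proj₂ xs) (unique-length uniq-xs)))
  play (suc f) (suc g) = play-step (play f (suc K)) (play (suc f) g)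

  win : Win empty []
  win = play (suc K) (suc K) (chain []) (λ { (tip ()) }) [] [] (ℕₚ.m≤m+n (suc K) 0) (ℕₚ.m≤m+n (suc K) 0)

  winning-position : ∃[ G ] (∀ c → MonoTriangle G c)
  winning-position = winning-board win

-- From boards to chordal orientations of large dichromatic number.

argmax : ∀ {m} (f : Fin (suc m) → ℕ) → ∃[ i ] (∀ j → f j ≤ f i)
argmax {zero} f = zero , λ { zero → ℕₚ.≤-refl }
argmax {suc m} f with i , max ← argmax (f ∘ suc) with ℕₚ.≤-total (f zero) (f (suc i))
... | inj₁ f0≤ = suc i , λ { zero → f0≤ ; (suc j) → max j }
... | inj₂ ≤f0 = zero , λ { zero → ℕₚ.≤-refl ; (suc j) → ℕₚ.≤-trans (max j) ≤f0 }

-- Chordality will follow by finding a position whose two neighbours on the cycle are adjacent in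
-- the digraph, which an induced cycle of length at least 4 forbids.
record CycleNeighbours (k : ℕ) (i : Fin k) : Set where
  field
    prev next : Fin k
    prev~i    : CycAdj k prev i
    next~i    : CycAdj k next i
    prev≢i    : prev ≢ i
    next≢i    : next ≢ i
    prev≢next : prev ≢ next
    apart     : ¬ CycAdj k prev next

cycle-neighbours : ∀ {k} → 4 ≤ k → ∀ i → CycleNeighbours k i
cycle-neighbours {suc (suc (suc (suc k)))} (s≤s (s≤s (s≤s (s≤s z≤n)))) zero = record
  { prev = suc (suc (suc (fromℕ k))) ; next = suc zero
  ; prev~i = inj₂ (inj₂ (inj₂ (refl , cong (4 +_) (Finₚ.toℕ-fromℕ k))))
  ; next~i = inj₂ (inj₁ refl)
  ; prev≢i = λ () ; next≢i = λ () ; prev≢next = λ ()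
  ; apart = λ { (inj₁ ()) ; (inj₂ (inj₁ ())) ; (inj₂ (inj₂ (inj₁ (() , _)))) ; (inj₂ (inj₂ (inj₂ (() , _)))) } }
cycle-neighbours {suc (suc (suc (suc k)))} (s≤s (s≤s (s≤s (s≤s z≤n)))) (suc i) with toℕ i ℕ.≟ 2 + k
... | yes last = record
  { prev = inject₁ i ; next = zero
  ; prev~i = inj₁ (cong suc (Finₚ.toℕ-inject₁ i))
  ; next~i = inj₂ (inj₂ (inj₁ (refl , cong (2 +_) last)))
  ; prev≢i = λ eq → ℕₚ.1+n≢n (sym (trans (sym (Finₚ.toℕ-inject₁ i)) (cong toℕ eq)))
  ; next≢i = λ ()
  ; prev≢next = λ eq → case trans (sym prev) (cong toℕ eq) of λ ()
  ; apart = λ where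
      (inj₁ ())
      (inj₂ (inj₁ eq)) → case trans eq prev of λ ()
      (inj₂ (inj₂ (inj₁ (eq , _)))) → case trans (sym prev) eq of λ ()
      (inj₂ (inj₂ (inj₂ (_ , eq)))) → case trans (cong suc (sym prev)) eq of λ () }
  where
  prev : toℕ (inject₁ i) ≡ 2 + k
  prev = trans (Finₚ.toℕ-inject₁ i) last
... | no ¬last = record
  { prev = inject₁ i ; next = suc (suc (Fin.fromℕ< i<))
  ; prev~i = inj₁ (cong suc prev)
  ; next~i = inj₂ (inj₁ (cong suc (sym next)))
  ; prev≢i = λ eq → ℕₚ.1+n≢n (sym (trans (sym prev) (cong toℕ eq)))
  ; next≢i = λ eq → ℕₚ.1+n≢n (ℕₚ.suc-injective (trans (cong suc (sym next)) (cong toℕ eq)))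
  ; prev≢next = λ eq → ℕₚ.m≢1+m+n (toℕ i) (trans (sym prev) (trans (cong toℕ eq) (trans (cong (2 +_) (Finₚ.toℕ-fromℕ< i<)) (cong suc (ℕₚ.+-comm 1 (toℕ i))))))
  ; apart = λ where
      (inj₁ eq) → ℕₚ.1+n≢n (ℕₚ.suc-injective (trans (sym (cong (2 +_) (Finₚ.toℕ-fromℕ< i<))) (trans (sym eq) (cong suc prev))))
      (inj₂ (inj₁ eq)) → ℕₚ.m≢1+m+n (toℕ i) {2} (sym (trans (trans (cong suc (ℕₚ.+-comm (toℕ i) 2)) (cong (2 +_) (sym next))) (trans eq prev)))
      (inj₂ (inj₂ (inj₁ (eq , eq′)))) → case trans (sym (cong (2 +_) (trans next (cong suc (trans (sym prev) eq))))) eq′ of λ ()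
      (inj₂ (inj₂ (inj₂ (() , _)))) }
  where
  i< : toℕ i < 2 + k
  i< = ℕₚ.≤∧≢⇒< (ℕₚ.≤-pred (Finₚ.toℕ<n i)) ¬last
  prev : toℕ (inject₁ i) ≡ toℕ i
  prev = Finₚ.toℕ-inject₁ i
  next : suc (toℕ (Fin.fromℕ< i<)) ≡ suc (toℕ i)
  next = cong suc (Finₚ.toℕ-fromℕ< i<)

tournament-chordal : ∀ G → IsTournament G → ChordalOrientation G
tournament-chordal G tournament k 4≤k@(s≤s _) (c , injective , cycle) =
  apart (proj₁ (cycle prev next prev≢next) (adjacent (tournament _ _ (prev≢next ∘ injective))))
  where
  open Adjacency G
  open CycleNeighbours (cycle-neighbours 4≤k zero)
  adjacent : ∀ {u v} → u ⇒ v ⊎ v ⇒ u → u ~ v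
  adjacent = [ ⇒→~ , ⇐→~ ]′

-- Stronger than having no k-dicolouring: the monochromatic cycle is a triangle, which is what both
-- games and the recursive tournaments deliver.
Unavoidable : Digraph → ℕ → Set
Unavoidable G k = ∀ (c : Fin (n G) → Fin k) → ∃[ u ] (∃[ v ] (∃[ w ]
  ((arc G u v ≡ true × arc G v w ≡ true × arc G w u ≡ true) × c u ≡ c v × c v ≡ c w)))

unavoidable⇒¬dicolourable : ∀ {G k} → Unavoidable G k → ¬ Dicolourable G k
unavoidable⇒¬dicolourable {G} unavoidable (c , dicolouring)
  with u , v , w , (uv , vw , wu) , u≡v , v≡w ← unavoidable c =
  dicolouring 2 (corners G u v w) (triangle-cycle G uv vw wu) λ where
    zero             → refl
    (suc zero)       → sym u≡v
    (suc (suc zero)) → sym (trans u≡v v≡w)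

reverse : Digraph → Digraph
reverse G = record { n = n G ; arc = λ u v → arc G v u ; loopless = loopless G ; nodigon = λ u v → nodigon G v u }

reverse-chordal : ∀ {G} → ChordalOrientation G → ChordalOrientation (reverse G)
reverse-chordal {G} chordal k 4≤k (c , injective , cycle) =
  chordal k 4≤k (c , injective , λ i j i≢j →
    (λ p → proj₁ (cycle i j i≢j) (trans (Boolₚ.∨-comm (arc G (c j) (c i)) _) p)) ,
    (λ p → trans (Boolₚ.∨-comm (arc G (c i) (c j)) _) (proj₂ (cycle i j i≢j) p)))

reverse-unavoidable : ∀ {G k} → Unavoidable G k → Unavoidable (reverse G) k
reverse-unavoidable unavoidable c with u , v , w , (uv , vw , wu) , u≡v , v≡w ← unavoidable c =
  u , w , v , (wu , vw , uv) , trans u≡v v≡w , sym v≡w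

module Realise (k : ℕ) (Θ : Quadruple) where
  open Game (suc k) Θ
  open Quadruple Θ

  module _ (B : Board) where

    digraph : Digraph
    digraph = record
      { n = size B ; arc = λ u v → ρ B (toℕ u) (toℕ v)
      ; loopless = λ u → Boolₚ.¬-not λ p → asym B p p
      ; nodigon = λ u v p → Boolₚ.¬-not (asym B p) }

    -- The vertex of a cycle with the largest label has two earlier neighbours on it, which `elim`
    -- makes adjacent.
    digraph-chordal : ChordalOrientation digraph
    digraph-chordal (suc k) 4≤k (c , injective , cycle) with i , max ← argmax (toℕ ∘ c) =
      apart (proj₁ (cycle prev next prev≢next) (unsplit (elim B (below prev≢i) (below next≢i) (prev≢next ∘ injective ∘ Finₚ.toℕ-injective)
        (~-split (proj₂ (cycle prev i prev≢i) prev~i)) (~-split (proj₂ (cycle next i next≢i) next~i)))))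
      where
      open Adjacency digraph
      open CycleNeighbours (cycle-neighbours 4≤k i)
      below : ∀ {j} → j ≢ i → toℕ (c j) < toℕ (c i)
      below j≢i = ℕₚ.≤∧≢⇒< (max _) (j≢i ∘ injective ∘ Finₚ.toℕ-injective)
      unsplit : ∀ {u v} → u ⇒ v ⊎ v ⇒ u → u ~ v
      unsplit = [ ⇒→~ , ⇐→~ ]′

    -- Colourings in the game are defined on all labels, so those outside the board need a default.
    -- The extra colour `zero` provides it even for `k` = 0, which is why the game has `suc k`
    -- colours.
    extend : (Fin (size B) → Fin k) → ℕ → Fin (suc k)
    extend c x with x ℕ.<? size B
    ... | yes x< = suc (c (Fin.fromℕ< x<))
    ... | no _   = zero

    extend-< : ∀ c {x} (x< : x < size B) → extend c x ≡ suc (c (Fin.fromℕ< x<))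
    extend-< c {x} x< with x ℕ.<? size B
    ... | yes _ = refl
    ... | no x≮ = contradiction x< x≮

    digraph-unavoidable : (∀ c → MonoTriangle B c) → Unavoidable digraph k
    digraph-unavoidable mono c with u , v , w , (uv , vw , wu) , u≡v , v≡w ← mono (extend c) =
      fin u< , fin v< , fin w< , (arcs u< v< uv , arcs v< w< vw , arcs w< u< wu) , colours u< v< u≡v , colours v< w< v≡w
      where
      fin : ∀ {x} → x < size B → Fin (size B)
      fin x< = Fin.fromℕ< x<

      u< : u < size B
      u< = proj₁ (bounded B uv)
      v< : v < size B
      v< = proj₁ (bounded B vw)
      w< : w < size B
      w< = proj₁ (bounded B wu)

      arcs : ∀ {x y} (x< : x < size B) (y< : y < size B) → ρ B x y ≡ true → ρ B (toℕ (fin x<)) (toℕ (fin y<)) ≡ true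
      arcs x< y< p rewrite Finₚ.toℕ-fromℕ< x< | Finₚ.toℕ-fromℕ< y< = p

      colours : ∀ {x y} (x< : x < size B) (y< : y < size B) → extend c x ≡ extend c y → c (fin x<) ≡ c (fin y<)
      colours x< y< eq = Finₚ.suc-injective (trans (sym (extend-< c x<)) (trans eq (extend-< c y<)))

    module _ (H : Digraph) (tournament : IsTournament H) where
      open Adjacency H

      embedded-quad : ∀ (f : Fin (n H) → Fin (size B)) → (∀ u v → arc H u v ≡ ρ B (toℕ (f u)) (toℕ (f v))) →
        ∀ {a b c w} → a ⇒ b → b ⇒ c → c ⇒ a → w ≢ a → w ≢ b → w ≢ c → Holds (ρ B) (toℕ (f a)) (toℕ (f b)) (toℕ (f c)) (toℕ (f w))
      embedded-quad f arcs ab bc ca w≢a w≢b w≢c = quad B (image ab) (image bc) (image ca) (adjacent w≢a) (adjacent w≢b) (adjacent w≢c)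
        where
        image : ∀ {u v} → u ⇒ v → ρ B (toℕ (f u)) (toℕ (f v)) ≡ true
        image p = trans (sym (arcs _ _)) p
        adjacent : ∀ {u v} → u ≢ v → Adj (ρ B) (toℕ (f u)) (toℕ (f v))
        adjacent u≢v = Sum.map image image (tournament _ _ u≢v)

-- Tournaments of large dichromatic number, by iterating Δ(1,T,T).

module CyclicJoin (T : Digraph) where

  Part : Set
  Part = Maybe (Fin (n T) ⊎ Fin (n T))

  part : Fin (suc (n T + n T)) → Part
  part zero    = nothing
  part (suc i) = just (Fin.splitAt (n T) i)

  part-injective : ∀ {u v} → part u ≡ part v → u ≡ v
  part-injective {zero} {zero} eq = refl
  part-injective {suc i} {suc j} eq = cong suc (trans (sym (Finₚ.join-splitAt (n T) (n T) i))
    (trans (cong (Fin.join (n T) (n T)) (just-injective eq)) (Finₚ.join-splitAt (n T) (n T) j)))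

  part-arc : Part → Part → Bool
  part-arc nothing         (just (inj₁ _)) = true
  part-arc (just (inj₁ _)) (just (inj₂ _)) = true
  part-arc (just (inj₂ _)) nothing         = true
  part-arc (just (inj₁ u)) (just (inj₁ v)) = arc T u v
  part-arc (just (inj₂ u)) (just (inj₂ v)) = arc T u v
  part-arc _               _               = false

  part-loopless : ∀ p → part-arc p p ≡ false
  part-loopless nothing         = refl
  part-loopless (just (inj₁ u)) = loopless T u
  part-loopless (just (inj₂ u)) = loopless T u

  part-nodigon : ∀ p q → part-arc p q ≡ true → part-arc q p ≡ false
  part-nodigon nothing         (just (inj₁ _)) _ = refl
  part-nodigon (just (inj₁ _)) (just (inj₂ _)) _ = refl
  part-nodigon (just (inj₂ _)) nothing         _ = refl
  part-nodigon (just (inj₁ u)) (just (inj₁ v)) p = nodigon T u v p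
  part-nodigon (just (inj₂ u)) (just (inj₂ v)) p = nodigon T u v p

  part-tournament : IsTournament T → ∀ p q → p ≢ q → part-arc p q ≡ true ⊎ part-arc q p ≡ true
  part-tournament t nothing         nothing         p≢q = contradiction refl p≢q
  part-tournament t nothing         (just (inj₁ _)) p≢q = inj₁ refl
  part-tournament t nothing         (just (inj₂ _)) p≢q = inj₂ refl
  part-tournament t (just (inj₁ _)) nothing         p≢q = inj₂ refl
  part-tournament t (just (inj₂ _)) nothing         p≢q = inj₁ refl
  part-tournament t (just (inj₁ u)) (just (inj₁ v)) p≢q = t u v λ { refl → p≢q refl }
  part-tournament t (just (inj₁ u)) (just (inj₂ v)) p≢q = inj₁ refl
  part-tournament t (just (inj₂ u)) (just (inj₁ v)) p≢q = inj₂ refl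
  part-tournament t (just (inj₂ u)) (just (inj₂ v)) p≢q = t u v λ { refl → p≢q refl }

  cyclic-join : Digraph
  cyclic-join = record
    { n = suc (n T + n T) ; arc = λ u v → part-arc (part u) (part v)
    ; loopless = λ u → part-loopless (part u) ; nodigon = λ u v → part-nodigon (part u) (part v) }

  cyclic-join-tournament : IsTournament T → IsTournament cyclic-join
  cyclic-join-tournament t u v u≢v = part-tournament t (part u) (part v) (u≢v ∘ part-injective)

  left right : Fin (n T) → Fin (suc (n T + n T))
  left  u = suc (u Fin.↑ˡ n T)
  right u = suc (n T Fin.↑ʳ u)

  MonoIn : ∀ {k} → (Fin (suc (n T + n T)) → Fin k) → Set
  MonoIn c = ∃[ u ] (∃[ v ] (∃[ w ] ((arc cyclic-join u v ≡ true × arc cyclic-join v w ≡ true × arc cyclic-join w u ≡ true) × c u ≡ c v × c v ≡ c w)))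

  -- A copy of T either uses the colour of the apex or has only k colours left.
  meets-or-mono : ∀ {k} (c : Fin (suc (n T + n T)) → Fin (suc k)) (copy : Fin (n T) → Fin (suc (n T + n T))) →
                  (∀ u v → arc T u v ≡ arc cyclic-join (copy u) (copy v)) → Unavoidable T k →
                  (∃[ u ] (c zero ≡ c (copy u))) ⊎ MonoIn c
  meets-or-mono c copy arcs unavoidable with Finₚ.any? (λ u → c zero Fin.≟ c (copy u))
  ... | yes meets = inj₁ meets
  ... | no misses with u , v , w , (uv , vw , wu) , u≡v , v≡w ← unavoidable (λ u → Fin.punchOut (λ eq → misses (u , eq)))
    = inj₂ (copy u , copy v , copy w , (trans (sym (arcs u v)) uv , trans (sym (arcs v w)) vw , trans (sym (arcs w u)) wu) ,
        Finₚ.punchOut-injective (λ eq → misses (u , eq)) (λ eq → misses (v , eq)) u≡v ,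
        Finₚ.punchOut-injective (λ eq → misses (v , eq)) (λ eq → misses (w , eq)) v≡w)

  -- If both copies contain the colour of the apex, at `left u` and `right v` say, then apex →
  -- `left u` → `right v` → apex is monochromatic.
  cyclic-join-unavoidable : ∀ {k} → Unavoidable T k → Unavoidable cyclic-join (suc k)
  cyclic-join-unavoidable unavoidable c
    with meets-or-mono c left left-arcs unavoidable | meets-or-mono c right right-arcs unavoidable
    where
    left-arcs : ∀ u v → arc T u v ≡ arc cyclic-join (left u) (left v)
    left-arcs u v rewrite Finₚ.splitAt-↑ˡ (n T) u (n T) | Finₚ.splitAt-↑ˡ (n T) v (n T) = refl
    right-arcs : ∀ u v → arc T u v ≡ arc cyclic-join (right u) (right v)
    right-arcs u v rewrite Finₚ.splitAt-↑ʳ (n T) (n T) u | Finₚ.splitAt-↑ʳ (n T) (n T) v = refl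
  ... | inj₂ mono | _ = mono
  ... | inj₁ _ | inj₂ mono = mono
  ... | inj₁ (u , 0≡u) | inj₁ (v , 0≡v) =
    zero , left u , right v , (apex-left , left-right , right-apex) , 0≡u , trans (sym 0≡u) 0≡v
    where
    apex-left : arc cyclic-join zero (left u) ≡ true
    apex-left rewrite Finₚ.splitAt-↑ˡ (n T) u (n T) = refl
    left-right : arc cyclic-join (left u) (right v) ≡ true
    left-right rewrite Finₚ.splitAt-↑ˡ (n T) u (n T) | Finₚ.splitAt-↑ʳ (n T) (n T) v = refl
    right-apex : arc cyclic-join (right v) zero ≡ true
    right-apex rewrite Finₚ.splitAt-↑ʳ (n T) (n T) v = refl

unavoidable-tournament : ∀ k → ∃[ T ] (IsTournament T × Unavoidable T k)
unavoidable-tournament zero =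
  -- A vertex is needed, since the empty digraph does have a colouring with 0 colours.
  record { n = 1 ; arc = λ _ _ → false ; loopless = λ _ → refl ; nodigon = λ _ _ () } ,
  (λ { zero zero ne → contradiction refl ne }) , λ c → case c zero of λ ()
unavoidable-tournament (suc k) with T , tournament , unavoidable ← unavoidable-tournament k =
  cyclic-join , cyclic-join-tournament tournament , cyclic-join-unavoidable unavoidable
  where open CyclicJoin T

-- The two directions of the characterisation.

↪ᵢ-trans : ∀ {G H K} → G ↪ᵢ H → H ↪ᵢ K → G ↪ᵢ K
↪ᵢ-trans (f , f-injective , f-arcs) (g , g-injective , g-arcs) =
  g ∘ f , f-injective ∘ g-injective , λ u v → trans (f-arcs u v) (g-arcs (f u) (f v))

hero-of-embedding : ∀ {H k} → H ↪ᵢ Δ11 k → HeroInChordalOrientations H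
hero-of-embedding {H} {k} H↪Δ = 2 ^ suc (k + k) , λ G chordal free →
  Colouring.dicolourable G chordal k λ Δ↪G → free (↪ᵢ-trans {H} {Δ11 k} {G} H↪Δ Δ↪G)

module Necessity (H : Digraph) (hero : HeroInChordalOrientations H) where
  open Adjacency H

  k : ℕ
  k = proj₁ hero

  -- Only the double negation of an embedding is obtained, so its consequences are stated as
  -- contradictions or extracted by decidability.
  not-free : ∀ {G} → ChordalOrientation G → Unavoidable G k → ¬ (H -free) G
  not-free {G} chordal unavoidable free = unavoidable⇒¬dicolourable {G} unavoidable (proj₂ hero G chordal free)

  tournament? : Dec (IsTournament H)
  tournament? = Finₚ.all? λ u → Finₚ.all? λ v → ¬? (u Fin.≟ v) →-dec ((u ⇒? v) ⊎-dec (v ⇒? u))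

  tournament : IsTournament H
  tournament = decidable-stable tournament? λ ¬tournament →
    not-free {T} (tournament-chordal T T-tournament) unavoidable λ (f , injective , arcs) →
      ¬tournament λ u v u≢v → Sum.map (trans (arcs u v)) (trans (arcs v u)) (T-tournament (f u) (f v) (u≢v ∘ injective))
    where
    T : Digraph
    T = proj₁ (unavoidable-tournament k)
    T-tournament : IsTournament T
    T-tournament = proj₁ (proj₂ (unavoidable-tournament k))
    unavoidable : Unavoidable T k
    unavoidable = proj₂ (proj₂ (unavoidable-tournament k))

  module Undominated (B : Game.Board (suc k) undominated) (mono : ∀ c → Game.MonoTriangle (suc k) undominated B c) where
    open Realise k undominated

    no-source : ∀ {a b c w} → a ⇒ b → b ⇒ c → c ⇒ a → w ⇒ a → w ⇒ b → w ⇒ c → ⊥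
    no-source ab bc ca wa wb wc = not-free {digraph B} (digraph-chordal B) (digraph-unavoidable B mono) λ (f , _ , arcs) →
      embedded-quad B H tournament f arcs ab bc ca (⇒⇒≢ wa) (⇒⇒≢ wb) (⇒⇒≢ wc)
        (trans (sym (arcs _ _)) wa , trans (sym (arcs _ _)) wb , trans (sym (arcs _ _)) wc)

    no-sink : ∀ {a b c w} → a ⇒ b → b ⇒ c → c ⇒ a → a ⇒ w → b ⇒ w → c ⇒ w → ⊥
    no-sink ab bc ca aw bw cw = not-free {reverse (digraph B)} (reverse-chordal {digraph B} (digraph-chordal B))
      (reverse-unavoidable {digraph B} (digraph-unavoidable B mono)) λ (f , _ , arcs) →
      -- Reversal turns the triangle around, hence the order `ca`, `bc`, `ab`.
      embedded-quad B (reverse H) (λ u v u≢v → swap (tournament u v u≢v)) f (λ u v → arcs v u) ca bc ab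
        (⇒⇒≢ aw ∘ sym) (⇒⇒≢ cw ∘ sym) (⇒⇒≢ bw ∘ sym)
        (trans (sym (arcs _ _)) aw , trans (sym (arcs _ _)) cw , trans (sym (arcs _ _)) bw)

  no-source : ∀ {a b c w} → a ⇒ b → b ⇒ c → c ⇒ a → w ⇒ a → w ⇒ b → w ⇒ c → ⊥
  no-source = let B , mono = UndominatedGame.winning-position (suc k) in Undominated.no-source B mono

  no-sink : ∀ {a b c w} → a ⇒ b → b ⇒ c → c ⇒ a → a ⇒ w → b ⇒ w → c ⇒ w → ⊥
  no-sink = let B , mono = UndominatedGame.winning-position (suc k) in Undominated.no-sink B mono

  Spans : V → V → Set
  Spans x y = ∀ w → w ≢ x → w ≢ y → y ⇒ w × w ⇒ x

  spans? : ∀ x y → Dec (Spans x y)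
  spans? x y = Finₚ.all? λ w → ¬? (w Fin.≟ x) →-dec (¬? (w Fin.≟ y) →-dec ((y ⇒? w) ×-dec (w ⇒? x)))

  module NestedBoard (B : Game.Board (suc k) nested) (mono : ∀ c → Game.MonoTriangle (suc k) nested B c) where
    open Realise k nested
    open Game (suc k) nested using (ρ; size)

    module _ (f : V → Fin (size B)) (injective : Injective _≡_ _≡_ f)
             (arcs : ∀ u v → arc H u v ≡ ρ B (toℕ (f u)) (toℕ (f v))) where

      -- A vertex `w` outside the triangle dominates it, is dominated by it, or satisfies b → w → a;
      -- the first two are excluded by `no-source` and `no-sink`.
      spans : ∀ {a b c} → a ⇒ b → b ⇒ c → c ⇒ a → toℕ (f a) < toℕ (f c) → toℕ (f b) < toℕ (f c) → Spans a b
      spans {a} {b} {c} ab bc ca a<c b<c w w≢a w≢b with w Fin.≟ c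
      ... | yes refl = bc , ca
      ... | no w≢c with embedded-quad B H tournament f arcs ab bc ca w≢a w≢b w≢c a<c b<c
      ... | inj₁ (wa , wb , wc) = ⊥-elim (no-source ab bc ca (trans (arcs _ _) wa) (trans (arcs _ _) wb) (trans (arcs _ _) wc))
      ... | inj₂ (inj₁ (aw , bw , cw)) = ⊥-elim (no-sink ab bc ca (trans (arcs _ _) aw) (trans (arcs _ _) bw) (trans (arcs _ _) cw))
      ... | inj₂ (inj₂ (bw , wa)) = trans (arcs _ _) bw , trans (arcs _ _) wa

      distinct : ∀ {u v} → u ⇒ v → toℕ (f u) ≢ toℕ (f v)
      distinct uv = ⇒⇒≢ uv ∘ injective ∘ Finₚ.toℕ-injective

      -- The images have distinct labels, and `spans` applies to the arc between the two smaller
      -- ones.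
      spanned-if-embedded : ∀ {a b c} → a ⇒ b → b ⇒ c → c ⇒ a → ¬ Spans a b → ¬ Spans b c → ¬ Spans c a → ⊥
      spanned-if-embedded {a} {b} {c} ab bc ca ¬ab ¬bc ¬ca with ℕₚ.<-cmp (toℕ (f a)) (toℕ (f b)) | ℕₚ.<-cmp (toℕ (f b)) (toℕ (f c)) | ℕₚ.<-cmp (toℕ (f c)) (toℕ (f a))
      ... | tri≈ _ eq _ | _ | _ = distinct ab eq
      ... | _ | tri≈ _ eq _ | _ = distinct bc eq
      ... | _ | _ | tri≈ _ eq _ = distinct ca eq
      ... | tri< a<b _ _ | tri< b<c _ _ | _ = ¬ab (spans ab bc ca (ℕₚ.<-trans a<b b<c) b<c)
      ... | tri> _ _ b<a | _ | tri< c<a _ _ = ¬bc (spans bc ca ab b<a c<a)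
      ... | tri> _ _ b<a | _ | tri> _ _ a<c = ¬ab (spans ab bc ca a<c (ℕₚ.<-trans b<a a<c))
      ... | tri< a<b _ _ | tri> _ _ c<b | _ = ¬ca (spans ca ab bc c<b a<b)

    some-spanning-arc : ∀ {a b c} → a ⇒ b → b ⇒ c → c ⇒ a → ¬ Spans a b → ¬ Spans b c → ¬ Spans c a → ⊥
    some-spanning-arc ab bc ca ¬ab ¬bc ¬ca = not-free {digraph B} (digraph-chordal B) (digraph-unavoidable B mono)
      λ (f , injective , arcs) → spanned-if-embedded f injective arcs ab bc ca ¬ab ¬bc ¬ca

  some-spanning-arc : ∀ {a b c} → a ⇒ b → b ⇒ c → c ⇒ a → ¬ Spans a b → ¬ Spans b c → ¬ Spans c a → ⊥
  some-spanning-arc = let B , mono = NestedGame.winning-position k in NestedBoard.some-spanning-arc B mono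

  iso : ∀ {a b c} → a ⇒ b → b ⇒ c → c ⇒ a → Spans a b → ∃[ k ] (k ≥ 1 × H ≅ Δ11 k)
  iso ab bc ca s = Δ-isomorphism H tournament ab (λ w≢a w≢b → s _ w≢a w≢b) (⇒⇒≢ ca) (⇒⇒≢ bc ∘ sym)
    λ ya yb yc xy yz zx → no-source xy yz zx ya yb yc

  conclusion : IsTransitiveTournament H ⊎ ∃[ k ] (k ≥ 1 × H ≅ Δ11 k)
  conclusion with Finₚ.any? (λ a → Finₚ.any? λ b → Finₚ.any? λ c → (a ⇒? b) ×-dec ((b ⇒? c) ×-dec (c ⇒? a)))
  ... | no none = inj₁ (tournament , no-triangle⇒acyclic H tournament λ ab bc ca → none (_ , _ , _ , ab , bc , ca))
  ... | yes (a , b , c , ab , bc , ca) with spans? a b | spans? b c | spans? c a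
  ... | no ¬ab | no ¬bc | no ¬ca = ⊥-elim (some-spanning-arc ab bc ca ¬ab ¬bc ¬ca)
  ... | yes s | _ | _ = inj₂ (iso ab bc ca s)
  ... | no _ | yes s | _ = inj₂ (iso bc ca ab s)
  ... | no _ | no _ | yes s = inj₂ (iso ca ab bc s)

theorem1p2 : (H : Digraph) →
    HeroInChordalOrientations H ⇔
    (IsTransitiveTournament H ⊎ ∃[ k ] (k ≥ 1 × H ≅ Δ11 k))
theorem1p2 H = mk⇔ (Necessity.conclusion H) λ where
  (inj₁ transitive) → hero-of-embedding {H} (transitive-embedding H transitive)
  (inj₂ (k , _ , f , injective , _ , arcs)) → hero-of-embedding {H} {k} (f , injective , arcs)
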